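{- Let $l\ge 2$ be an integer and let $q=p^e$ be a power of a prime $p\notin\{2,3\}$ with $q\equiv 1\pmod l$. Let $S$ be a multiplicative character on $\mathbb{F}_q$ of order $l$ and, when $q\equiv1\pmod 3$, let $\chi_3$ be a multiplicative character on $\mathbb{F}_q$ of order $3$. Then for $\lambda=\frac13$: $$-a_q(C_{l,\lambda})=\begin{cases}0, & \text{if } l\ne 3 \text{ and } q\equiv 2\pmod 3;\\[2mm] q\displaystyle\sum_{i=1}^{l-1}S^i\!\left(\tfrac{27}{8}\right)\left[\binom{\chi_3}{S^i}+\binom{\chi_3^2}{S^i}\right], & \text{if } l\neq 3\text{ and } q\equiv 1\pmod 3;\\[2mm] 2+q\displaystyle\sum_{i=1}^{2}\left[\binom{\chi_3}{\chi_3^i}+\binom{\chi_3^2}{\chi_3^i}\right], & \text{if } l=3.\end{cases}$$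
   Context: Multiplicative characters on $\mathbb{F}_q^\times$ are complex valued and are all (including the trivial one) extended to $\mathbb{F}_q$ by $\chi(0):=0$; $\overline{B}$ is the inverse of $B$. The binomial coefficient is $\binom{A}{B}:=\frac{B(-1)}{q}\sum_{x\in\mathbb{F}_q}A(x)\overline{B}(1-x)$. Rational numbers with denominator prime to $p$ are regarded as elements of $\mathbb{F}_q$ by reduction mod $p$. $C_{l,\lambda}$ is the nonsingular projective algebraic curve over $\mathbb{Q}$ with affine equation $y^l=(x-1)(x^2+\lambda)$. For a prime $p$ of good reduction and $q=p^e$, $a_q(C_{l,\lambda}):=1+q-\#C_{l,\lambda}(\mathbb{F}_q)$. The number of points $\#C_{l,\lambda}(\mathbb{F}_q)$ is taken as follows: with $N=\#\{(x,y)\in\mathbb{F}_q^2: y^l=(x-1)(x^2+\lambda)\}$, $\#C_{l,\lambda}(\mathbb{F}_q)=1+N$ for every $l\neq 3$, and $\#C_{3,\lambda}(\mathbb{F}_q)=3+N$ for $l=3$ and $q\equiv 1\pmod 3$. A prime $p\nmid l$ is of good reduction iff $\mathrm{ord}_p(\lambda(\lambda+1))=0$. -}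

module Defs where

open import Level using (Level; 0ℓ; _⊔_) renaming (suc to lsuc)
open import Algebra.Bundles using (CommutativeRing; Semiring; Monoid; Group; AbelianGroup)
open import Algebra.Morphism.Structures using (IsMonoidHomomorphism)
import Algebra.Definitions.RawMonoid as RawMonoidDefs
import Algebra.Definitions.RawSemiring as RawSemiringDefs
open import Data.Bool.Base using (if_then_else_)
open import Data.Fin.Base as Fin using (Fin; toℕ)
import Data.Fin.Properties as Fin
open import Data.Integer.Base as ℤ using (ℤ; +_; -[1+_])
import Data.Integer.Divisibility as ℤ
open import Data.List.Base as List using (List; allFin; cartesianProduct; filter; length)
open import Data.Nat.Base as ℕ using (ℕ; zero; suc)
import Data.Nat.Properties as ℕ
open import Data.Product.Base using (_×_; _,_; proj₁; proj₂; ∃)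
open import Data.Rational.Base as ℚ using (ℚ; 0ℚ; 1ℚ; ½; ↥_; ↧ₙ_)
import Data.Rational.Properties as ℚ
open import Data.Rational.Solver using (module +-*-Solver)
open import Function.Base using (_∘_)
open import Function.Bundles using (Inverse; Injection)
open import Function.Properties.Inverse using (Inverse⇒Injection)
open import Relation.Binary.Core using (Rel)
open import Relation.Binary.Definitions using (Decidable; Reflexive; Symmetric; Transitive)
open import Relation.Binary.Structures using (IsEquivalence)
open import Relation.Binary.PropositionalEquality as ≡ using (_≡_; _≢_)
import Relation.Binary.Reasoning.Setoid as SetoidReasoning
open import Relation.Nullary using (¬_; Dec; yes; no; does; contradiction)
open import Relation.Nullary.Decidable using (via-injection)

private
  variable
    a b c ℓ : Level

infix 4 _≡_[mod_]

_≡_[mod_] : ℕ → ℕ → ℕ → Set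
m ≡ n [mod k ] = (+ k) ℤ.∣ ((+ m) ℤ.- (+ n))

module _ (G : Group a b) where
  open Group G
  open RawMonoidDefs rawMonoid using () renaming (_×_ to _times_)

  -- In multiplicative notation `n times g` is gⁿ.
  HasOrder : Carrier → ℕ → Set b
  HasOrder g n =
    (0 ℕ.< n) × (n times g ≈ ε) × (∀ m → 0 ℕ.< m → m ℕ.< n → ¬ (m times g ≈ ε))

-- P is a filter base on I: on ℕ it will be the tails {n ≥ N}, on ℕ × ℕ
-- their squares.
module Vanishing {I : Set} (P : ℕ → I → Set)
                 (P-mono : ∀ {M N i} → M ℕ.≤ N → P N i → P M i) where

  Vanishes : (I → ℚ) → Set
  Vanishes f = ∀ ε → 0ℚ ℚ.< ε → ∃ λ N → ∀ i → P N i → ℚ.∣ f i ∣ ℚ.< ε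

  Bounded : (I → ℚ) → Set
  Bounded f = ∃ λ B → (0ℚ ℚ.< B) × ∃ λ N → ∀ i → P N i → ℚ.∣ f i ∣ ℚ.≤ B

  vanishes-ext : ∀ {f g} → (∀ i → f i ≡ g i) → Vanishes f → Vanishes g
  vanishes-ext eq vf ε ε>0 with vf ε ε>0
  ... | N , h = N , λ i p → ≡.subst (λ z → ℚ.∣ z ∣ ℚ.< ε) (eq i) (h i p)

  vanishes-0 : Vanishes (λ _ → 0ℚ)
  vanishes-0 ε ε>0 = 0 , λ _ _ → ε>0

  vanishes-neg : ∀ {f} → Vanishes f → Vanishes (λ i → ℚ.- f i)
  vanishes-neg {f} vf ε ε>0 with vf ε ε>0
  ... | N , h = N , λ i p → ≡.subst (ℚ._< ε) (≡.sym (ℚ.∣-p∣≡∣p∣ (f i))) (h i p)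

  vanishes-+ : ∀ {f g} → Vanishes f → Vanishes g → Vanishes (λ i → f i ℚ.+ g i)
  vanishes-+ {f} {g} vf vg ε ε>0 = M ℕ.⊔ N , bound
    where
    δ = ½ ℚ.* ε

    δ>0 : 0ℚ ℚ.< δ
    δ>0 = ≡.subst (ℚ._< δ) (ℚ.*-zeroʳ ½) (ℚ.*-monoʳ-<-pos ½ ε>0)

    δ+δ≡ε : δ ℚ.+ δ ≡ ε
    δ+δ≡ε = ≡.trans (≡.sym (ℚ.*-distribʳ-+ ε ½ ½)) (ℚ.*-identityˡ ε)

    M = proj₁ (vf δ δ>0)
    N = proj₁ (vg δ δ>0)

    bound : ∀ i → P (M ℕ.⊔ N) i → ℚ.∣ f i ℚ.+ g i ∣ ℚ.< ε
    bound i p = begin-strict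
      ℚ.∣ f i ℚ.+ g i ∣          ≤⟨ ℚ.∣p+q∣≤∣p∣+∣q∣ (f i) (g i) ⟩
      ℚ.∣ f i ∣ ℚ.+ ℚ.∣ g i ∣    <⟨ ℚ.+-mono-< (proj₂ (vf δ δ>0) i (P-mono (ℕ.m≤m⊔n M N) p))
                                               (proj₂ (vg δ δ>0) i (P-mono (ℕ.m≤n⊔m M N) p)) ⟩
      δ ℚ.+ δ                    ≡⟨ δ+δ≡ε ⟩
      ε                          ∎
      where open ℚ.≤-Reasoning

  vanishes-* : ∀ {f g} → Bounded f → Vanishes g → Vanishes (λ i → f i ℚ.* g i)
  vanishes-* {f} {g} (B , B>0 , M , f≤B) vg ε ε>0 = M ℕ.⊔ N , bound
    where
    instance
      B-pos : ℚ.Positive B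
      B-pos = ℚ.positive B>0
      B-nonNeg : ℚ.NonNegative B
      B-nonNeg = ℚ.pos⇒nonNeg B
      B-nonZero : ℚ.NonZero B
      B-nonZero = ℚ.pos⇒nonZero B
      1/B-pos : ℚ.Positive (ℚ.1/ B)
      1/B-pos = ℚ.1/pos⇒pos B

    δ = ℚ.1/ B ℚ.* ε

    δ>0 : 0ℚ ℚ.< δ
    δ>0 = ≡.subst (ℚ._< δ) (ℚ.*-zeroʳ (ℚ.1/ B)) (ℚ.*-monoʳ-<-pos (ℚ.1/ B) ε>0)

    Bδ≡ε : B ℚ.* δ ≡ ε
    Bδ≡ε = ≡.trans (≡.sym (ℚ.*-assoc B (ℚ.1/ B) ε))
                   (≡.trans (≡.cong (ℚ._* ε) (ℚ.*-inverseʳ B)) (ℚ.*-identityˡ ε))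

    N = proj₁ (vg δ δ>0)

    bound : ∀ i → P (M ℕ.⊔ N) i → ℚ.∣ f i ℚ.* g i ∣ ℚ.< ε
    bound i p = begin-strict
      ℚ.∣ f i ℚ.* g i ∣          ≡⟨ ℚ.∣p*q∣≡∣p∣*∣q∣ (f i) (g i) ⟩
      ℚ.∣ f i ∣ ℚ.* ℚ.∣ g i ∣    ≤⟨ ℚ.*-monoʳ-≤-nonNeg ℚ.∣ g i ∣ {{ℚ.∣-∣-nonNeg (g i)}}
                                      (f≤B i (P-mono (ℕ.m≤m⊔n M N) p)) ⟩
      B ℚ.* ℚ.∣ g i ∣            <⟨ ℚ.*-monoʳ-<-pos B
                                      (proj₂ (vg δ δ>0) i (P-mono (ℕ.m≤n⊔m M N) p)) ⟩
      B ℚ.* δ                    ≡⟨ Bδ≡ε ⟩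
      ε                          ∎
      where open ℚ.≤-Reasoning

-- Cauchy sequences of rationals with explicit moduli of convergence; the
-- reals are this type modulo _≈ᴿ_.
record ℝ : Set where
  no-eta-equality
  constructor mkℝ
  field
    seq    : ℕ → ℚ
    cauchy : ∀ ε → 0ℚ ℚ.< ε → ∃ λ N → ∀ m n → N ℕ.≤ m → N ℕ.≤ n →
             ℚ.∣ seq m ℚ.- seq n ∣ ℚ.< ε

open ℝ public using (seq)

infix 4 _≈ᴿ_

record _≈ᴿ_ (x y : ℝ) : Set where
  no-eta-equality
  pattern
  constructor mk≈ᴿ
  field
    null : ∀ ε → 0ℚ ℚ.< ε → ∃ λ N → ∀ n → N ℕ.≤ n → ℚ.∣ seq x n ℚ.- seq y n ∣ ℚ.< ε

module Tail   = Vanishing (λ N n → N ℕ.≤ n) ℕ.≤-trans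
module Square = Vanishing {ℕ × ℕ} (λ N (m , n) → (N ℕ.≤ m) × (N ℕ.≤ n))
                  (λ M≤N (p , q) → ℕ.≤-trans M≤N p , ℕ.≤-trans M≤N q)

module ℚ-Identities where
  open +-*-Solver

  sum-diff : ∀ u v u′ v′ → (u ℚ.- u′) ℚ.+ (v ℚ.- v′) ≡ (u ℚ.+ v) ℚ.- (u′ ℚ.+ v′)
  sum-diff = solve 4 (λ u v u′ v′ →
    (u :- u′) :+ (v :- v′) := (u :+ v) :- (u′ :+ v′)) ≡.refl

  neg-diff : ∀ u u′ → ℚ.- (u ℚ.- u′) ≡ (ℚ.- u) ℚ.- (ℚ.- u′)
  neg-diff = solve 2 (λ u u′ → :- (u :- u′) := (:- u) :- (:- u′)) ≡.refl

  prod-diff : ∀ u v u′ v′ →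
    u ℚ.* (v ℚ.- v′) ℚ.+ v′ ℚ.* (u ℚ.- u′) ≡ (u ℚ.* v) ℚ.- (u′ ℚ.* v′)
  prod-diff = solve 4 (λ u v u′ v′ →
    u :* (v :- v′) :+ v′ :* (u :- u′) := (u :* v) :- (u′ :* v′)) ≡.refl

  swap-diff : ∀ u v → ℚ.- (u ℚ.- v) ≡ v ℚ.- u
  swap-diff = solve 2 (λ u v → :- (u :- v) := v :- u) ≡.refl

  add-diff : ∀ u v w → (u ℚ.- v) ℚ.+ (v ℚ.- w) ≡ u ℚ.- w
  add-diff = solve 3 (λ u v w → (u :- v) :+ (v :- w) := u :- w) ≡.refl

  sub-add : ∀ u v → v ℚ.+ (u ℚ.- v) ≡ u
  sub-add = solve 2 (λ u v → v :+ (u :- v) := u) ≡.refl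

open ℚ-Identities

diff : ℝ → ℕ × ℕ → ℚ
diff x (m , n) = seq x m ℚ.- seq x n

cauchy′ : ∀ x → Square.Vanishes (diff x)
cauchy′ x ε ε>0 with ℝ.cauchy x ε ε>0
... | N , h = N , λ (m , n) (p , q) → h m n p q

unpair : (f : ℕ → ℚ) → Square.Vanishes (λ (m , n) → f m ℚ.- f n) →
         ∀ ε → 0ℚ ℚ.< ε → ∃ λ N → ∀ m n → N ℕ.≤ m → N ℕ.≤ n → ℚ.∣ f m ℚ.- f n ∣ ℚ.< ε
unpair f v ε ε>0 = proj₁ (v ε ε>0) , λ m n p q → proj₂ (v ε ε>0) (m , n) (p , q)

∣∣-pos : ∀ p {r} → 0ℚ ℚ.< r → 0ℚ ℚ.< ℚ.∣ p ∣ ℚ.+ r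
∣∣-pos p {r} r>0 = ℚ.≤-<-trans (ℚ.0≤∣p∣ p)
  (≡.subst (ℚ._< ℚ.∣ p ∣ ℚ.+ r) (ℚ.+-identityʳ ℚ.∣ p ∣) (ℚ.+-monoʳ-< ℚ.∣ p ∣ r>0))

∣∣-near : ∀ p p′ {r} → ℚ.∣ p′ ℚ.- p ∣ ℚ.< r → ℚ.∣ p′ ∣ ℚ.≤ ℚ.∣ p ∣ ℚ.+ r
∣∣-near p p′ {r} near = begin
  ℚ.∣ p′ ∣                         ≡⟨ ≡.cong ℚ.∣_∣ (sub-add p′ p) ⟨
  ℚ.∣ p ℚ.+ (p′ ℚ.- p) ∣           ≤⟨ ℚ.∣p+q∣≤∣p∣+∣q∣ p (p′ ℚ.- p) ⟩
  ℚ.∣ p ∣ ℚ.+ ℚ.∣ p′ ℚ.- p ∣       ≤⟨ ℚ.+-monoʳ-≤ ℚ.∣ p ∣ (ℚ.<⇒≤ near) ⟩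
  ℚ.∣ p ∣ ℚ.+ r                    ∎
  where open ℚ.≤-Reasoning

bounded : ∀ x → Tail.Bounded (seq x)
bounded x with ℝ.cauchy x 1ℚ (ℚ.positive⁻¹ 1ℚ)
... | N , h = ℚ.∣ seq x N ∣ ℚ.+ 1ℚ , ∣∣-pos (seq x N) (ℚ.positive⁻¹ 1ℚ) , N ,
  λ n N≤n → ∣∣-near (seq x N) (seq x n) (h n N N≤n ℕ.≤-refl)

bounded₁ : ∀ x → Square.Bounded (λ mn → seq x (proj₁ mn))
bounded₁ x = lift (bounded x)
  where
  lift : Tail.Bounded (seq x) → Square.Bounded (λ mn → seq x (proj₁ mn))
  lift (B , B>0 , N , h) = B , B>0 , N , λ mn p → h (proj₁ mn) (proj₁ p)

bounded₂ : ∀ x → Square.Bounded (λ mn → seq x (proj₂ mn))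
bounded₂ x = lift (bounded x)
  where
  lift : Tail.Bounded (seq x) → Square.Bounded (λ mn → seq x (proj₂ mn))
  lift (B , B>0 , N , h) = B , B>0 , N , λ mn p → h (proj₂ mn) (proj₂ p)

infixl 6 _+ᴿ_
infixl 7 _*ᴿ_
infix  8 -ᴿ_

-- Copatterns keep the operations from unfolding during unification.
fromℚᴿ : ℚ → ℝ
fromℚᴿ r .seq _    = r
fromℚᴿ r .ℝ.cauchy = unpair (λ _ → r)
  (Square.vanishes-ext (λ _ → ≡.sym (ℚ.+-inverseʳ r)) Square.vanishes-0)

_+ᴿ_ : ℝ → ℝ → ℝ
(x +ᴿ y) .seq n    = seq x n ℚ.+ seq y n
(x +ᴿ y) .ℝ.cauchy = unpair (λ n → seq x n ℚ.+ seq y n)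
  (Square.vanishes-ext (λ (m , n) → sum-diff (seq x m) (seq y m) (seq x n) (seq y n))
    (Square.vanishes-+ (cauchy′ x) (cauchy′ y)))

-ᴿ_ : ℝ → ℝ
(-ᴿ x) .seq n    = ℚ.- seq x n
(-ᴿ x) .ℝ.cauchy = unpair (λ n → ℚ.- seq x n)
  (Square.vanishes-ext (λ (m , n) → neg-diff (seq x m) (seq x n))
    (Square.vanishes-neg (cauchy′ x)))

_*ᴿ_ : ℝ → ℝ → ℝ
(x *ᴿ y) .seq n    = seq x n ℚ.* seq y n
(x *ᴿ y) .ℝ.cauchy = unpair (λ n → seq x n ℚ.* seq y n)
  (Square.vanishes-ext (λ (m , n) → prod-diff (seq x m) (seq y m) (seq x n) (seq y n))
    (Square.vanishes-+ (Square.vanishes-* (bounded₁ x) (cauchy′ y))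
                       (Square.vanishes-* (bounded₂ y) (cauchy′ x))))

pointwise : ∀ {x y} → (∀ n → seq x n ≡ seq y n) → x ≈ᴿ y
pointwise {x} {y} eq = mk≈ᴿ (Tail.vanishes-ext
  (λ n → ≡.sym (≡.trans (≡.cong (ℚ._- seq y n) (eq n)) (ℚ.+-inverseʳ (seq y n))))
  Tail.vanishes-0)

≈ᴿ-refl : Reflexive _≈ᴿ_
≈ᴿ-refl {x} = pointwise {x} {x} λ _ → ≡.refl

≈ᴿ-sym : Symmetric _≈ᴿ_
≈ᴿ-sym {x} {y} (mk≈ᴿ v) = mk≈ᴿ
  (Tail.vanishes-ext (λ n → swap-diff (seq x n) (seq y n)) (Tail.vanishes-neg v))

≈ᴿ-trans : Transitive _≈ᴿ_
≈ᴿ-trans {x} {y} {z} (mk≈ᴿ v) (mk≈ᴿ w) = mk≈ᴿ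
  (Tail.vanishes-ext (λ n → add-diff (seq x n) (seq y n) (seq z n)) (Tail.vanishes-+ v w))

+ᴿ-cong : ∀ {x x′ y y′} → x ≈ᴿ x′ → y ≈ᴿ y′ → x +ᴿ y ≈ᴿ x′ +ᴿ y′
+ᴿ-cong {x} {x′} {y} {y′} (mk≈ᴿ v) (mk≈ᴿ w) = mk≈ᴿ (Tail.vanishes-ext
  (λ n → sum-diff (seq x n) (seq y n) (seq x′ n) (seq y′ n)) (Tail.vanishes-+ v w))

-ᴿ-cong : ∀ {x x′} → x ≈ᴿ x′ → -ᴿ x ≈ᴿ -ᴿ x′
-ᴿ-cong {x} {x′} (mk≈ᴿ v) = mk≈ᴿ
  (Tail.vanishes-ext (λ n → neg-diff (seq x n) (seq x′ n)) (Tail.vanishes-neg v))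

*ᴿ-cong : ∀ {x x′ y y′} → x ≈ᴿ x′ → y ≈ᴿ y′ → x *ᴿ y ≈ᴿ x′ *ᴿ y′
*ᴿ-cong {x} {x′} {y} {y′} (mk≈ᴿ v) (mk≈ᴿ w) = mk≈ᴿ (Tail.vanishes-ext
  (λ n → prod-diff (seq x n) (seq y n) (seq x′ n) (seq y′ n))
  (Tail.vanishes-+ (Tail.vanishes-* (bounded x) w) (Tail.vanishes-* (bounded y′) v)))

≈ᴿ-isEquivalence : IsEquivalence _≈ᴿ_
≈ᴿ-isEquivalence = record { refl = ≈ᴿ-refl ; sym = ≈ᴿ-sym ; trans = ≈ᴿ-trans }

+ᴿ-assoc : ∀ x y z → (x +ᴿ y) +ᴿ z ≈ᴿ x +ᴿ (y +ᴿ z)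
+ᴿ-assoc x y z = pointwise λ n → ℚ.+-assoc (seq x n) (seq y n) (seq z n)

+ᴿ-comm : ∀ x y → x +ᴿ y ≈ᴿ y +ᴿ x
+ᴿ-comm x y = pointwise λ n → ℚ.+-comm (seq x n) (seq y n)

+ᴿ-identityˡ : ∀ x → fromℚᴿ 0ℚ +ᴿ x ≈ᴿ x
+ᴿ-identityˡ x = pointwise λ n → ℚ.+-identityˡ (seq x n)

+ᴿ-identityʳ : ∀ x → x +ᴿ fromℚᴿ 0ℚ ≈ᴿ x
+ᴿ-identityʳ x = pointwise λ n → ℚ.+-identityʳ (seq x n)

-ᴿ-inverseˡ : ∀ x → (-ᴿ x) +ᴿ x ≈ᴿ fromℚᴿ 0ℚ
-ᴿ-inverseˡ x = pointwise λ n → ℚ.+-inverseˡ (seq x n)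

-ᴿ-inverseʳ : ∀ x → x +ᴿ (-ᴿ x) ≈ᴿ fromℚᴿ 0ℚ
-ᴿ-inverseʳ x = pointwise λ n → ℚ.+-inverseʳ (seq x n)

*ᴿ-assoc : ∀ x y z → (x *ᴿ y) *ᴿ z ≈ᴿ x *ᴿ (y *ᴿ z)
*ᴿ-assoc x y z = pointwise λ n → ℚ.*-assoc (seq x n) (seq y n) (seq z n)

*ᴿ-comm : ∀ x y → x *ᴿ y ≈ᴿ y *ᴿ x
*ᴿ-comm x y = pointwise λ n → ℚ.*-comm (seq x n) (seq y n)

*ᴿ-identityˡ : ∀ x → fromℚᴿ 1ℚ *ᴿ x ≈ᴿ x
*ᴿ-identityˡ x = pointwise λ n → ℚ.*-identityˡ (seq x n)

*ᴿ-identityʳ : ∀ x → x *ᴿ fromℚᴿ 1ℚ ≈ᴿ x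
*ᴿ-identityʳ x = pointwise λ n → ℚ.*-identityʳ (seq x n)

*ᴿ-distribˡ-+ᴿ : ∀ x y z → x *ᴿ (y +ᴿ z) ≈ᴿ (x *ᴿ y) +ᴿ (x *ᴿ z)
*ᴿ-distribˡ-+ᴿ x y z = pointwise λ n → ℚ.*-distribˡ-+ (seq x n) (seq y n) (seq z n)

*ᴿ-distribʳ-+ᴿ : ∀ x y z → (y +ᴿ z) *ᴿ x ≈ᴿ (y *ᴿ x) +ᴿ (z *ᴿ x)
*ᴿ-distribʳ-+ᴿ x y z = pointwise λ n → ℚ.*-distribʳ-+ (seq x n) (seq y n) (seq z n)

ℝ-commutativeRing : CommutativeRing 0ℓ 0ℓ
ℝ-commutativeRing = record
  { Carrier = ℝ ; _≈_ = _≈ᴿ_ ; _+_ = _+ᴿ_ ; _*_ = _*ᴿ_ ; -_ = -ᴿ_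
  ; 0# = fromℚᴿ 0ℚ ; 1# = fromℚᴿ 1ℚ
  ; isCommutativeRing = record
    { isRing = record
      { +-isAbelianGroup = record
        { isGroup = record
          { isMonoid = record
            { isSemigroup = record
              { isMagma = record { isEquivalence = ≈ᴿ-isEquivalence ; ∙-cong = +ᴿ-cong }
              ; assoc = +ᴿ-assoc
              }
            ; identity = +ᴿ-identityˡ , +ᴿ-identityʳ
            }
          ; inverse = -ᴿ-inverseˡ , -ᴿ-inverseʳ
          ; ⁻¹-cong = -ᴿ-cong
          }
        ; comm = +ᴿ-comm
        }
      ; *-cong = *ᴿ-cong
      ; *-assoc = *ᴿ-assoc
      ; *-identity = *ᴿ-identityˡ , *ᴿ-identityʳ
      ; distrib = *ᴿ-distribˡ-+ᴿ , *ᴿ-distribʳ-+ᴿ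
      }
    ; *-comm = *ᴿ-comm
    }
  }

record ℂ : Set where
  no-eta-equality
  constructor _+i_
  field
    re im : ℝ

open ℂ public using (re; im)

infix  4 _≈ᶜ_
infixl 6 _+ᶜ_
infixl 7 _*ᶜ_
infix  8 -ᶜ_

record _≈ᶜ_ (z w : ℂ) : Set where
  no-eta-equality
  pattern
  constructor _,_
  field
    re≈ : re z ≈ᴿ re w
    im≈ : im z ≈ᴿ im w

fromℚ : ℚ → ℂ
fromℚ r .re = fromℚᴿ r
fromℚ r .im = fromℚᴿ 0ℚ

fromℤ : ℤ → ℂ
fromℤ n = fromℚ (n ℚ./ 1)

_+ᶜ_ : ℂ → ℂ → ℂ
(z +ᶜ w) .re = re z +ᴿ re w
(z +ᶜ w) .im = im z +ᴿ im w

-ᶜ_ : ℂ → ℂ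
(-ᶜ z) .re = -ᴿ re z
(-ᶜ z) .im = -ᴿ im z

_*ᶜ_ : ℂ → ℂ → ℂ
(z *ᶜ w) .re = re z *ᴿ re w +ᴿ -ᴿ (im z *ᴿ im w)
(z *ᶜ w) .im = re z *ᴿ im w +ᴿ im z *ᴿ re w

private
  module ℂ-Identities where
    open +-*-Solver
    open import Data.Rational.Base using (_+_; _*_; -_)

    *-assoc-re : ∀ a b c d e f →
      (a * c + - (b * d)) * e + - ((a * d + b * c) * f) ≡
      a * (c * e + - (d * f)) + - (b * (c * f + d * e))
    *-assoc-re = solve 6 (λ a b c d e f →
      (a :* c :+ :- (b :* d)) :* e :+ :- ((a :* d :+ b :* c) :* f) :=
      a :* (c :* e :+ :- (d :* f)) :+ :- (b :* (c :* f :+ d :* e))) ≡.refl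

    *-assoc-im : ∀ a b c d e f →
      (a * c + - (b * d)) * f + (a * d + b * c) * e ≡
      a * (c * f + d * e) + b * (c * e + - (d * f))
    *-assoc-im = solve 6 (λ a b c d e f →
      (a :* c :+ :- (b :* d)) :* f :+ (a :* d :+ b :* c) :* e :=
      a :* (c :* f :+ d :* e) :+ b :* (c :* e :+ :- (d :* f))) ≡.refl

    *-comm-re : ∀ a b c d → a * c + - (b * d) ≡ c * a + - (d * b)
    *-comm-re = solve 4 (λ a b c d → a :* c :+ :- (b :* d) := c :* a :+ :- (d :* b)) ≡.refl

    *-comm-im : ∀ a b c d → a * d + b * c ≡ c * b + d * a
    *-comm-im = solve 4 (λ a b c d → a :* d :+ b :* c := c :* b :+ d :* a) ≡.refl

    *-identity-re : ∀ a b → 1ℚ * a + - (0ℚ * b) ≡ a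
    *-identity-re = solve 2 (λ a b → con 1ℚ :* a :+ :- (con 0ℚ :* b) := a) ≡.refl

    *-identity-im : ∀ a b → 1ℚ * b + 0ℚ * a ≡ b
    *-identity-im = solve 2 (λ a b → con 1ℚ :* b :+ con 0ℚ :* a := b) ≡.refl

    distrib-re : ∀ a b c d e f →
      a * (c + e) + - (b * (d + f)) ≡ (a * c + - (b * d)) + (a * e + - (b * f))
    distrib-re = solve 6 (λ a b c d e f →
      a :* (c :+ e) :+ :- (b :* (d :+ f)) :=
      (a :* c :+ :- (b :* d)) :+ (a :* e :+ :- (b :* f))) ≡.refl

    distrib-im : ∀ a b c d e f →
      a * (d + f) + b * (c + e) ≡ (a * d + b * c) + (a * f + b * e)
    distrib-im = solve 6 (λ a b c d e f →
      a :* (d :+ f) :+ b :* (c :+ e) :=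
      (a :* d :+ b :* c) :+ (a :* f :+ b :* e)) ≡.refl

  open ℂ-Identities

  reₙ imₙ : ℂ → ℕ → ℚ
  reₙ z = seq (re z)
  imₙ z = seq (im z)

  ≈ᶜ-refl : Reflexive _≈ᶜ_
  ≈ᶜ-refl = ≈ᴿ-refl , ≈ᴿ-refl

  ≈ᶜ-sym : Symmetric _≈ᶜ_
  ≈ᶜ-sym (p , q) = ≈ᴿ-sym p , ≈ᴿ-sym q

  ≈ᶜ-trans : Transitive _≈ᶜ_
  ≈ᶜ-trans (p , q) (p′ , q′) = ≈ᴿ-trans p p′ , ≈ᴿ-trans q q′

  ≈ᶜ-isEquivalence : IsEquivalence _≈ᶜ_
  ≈ᶜ-isEquivalence = record { refl = ≈ᶜ-refl ; sym = ≈ᶜ-sym ; trans = ≈ᶜ-trans }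

  +ᶜ-cong : ∀ {z z′ w w′} → z ≈ᶜ z′ → w ≈ᶜ w′ → z +ᶜ w ≈ᶜ z′ +ᶜ w′
  +ᶜ-cong (p , q) (p′ , q′) = +ᴿ-cong p p′ , +ᴿ-cong q q′

  -ᶜ-cong : ∀ {z z′} → z ≈ᶜ z′ → -ᶜ z ≈ᶜ -ᶜ z′
  -ᶜ-cong (p , q) = -ᴿ-cong p , -ᴿ-cong q

  *ᶜ-cong : ∀ {z z′ w w′} → z ≈ᶜ z′ → w ≈ᶜ w′ → z *ᶜ w ≈ᶜ z′ *ᶜ w′
  *ᶜ-cong (p , q) (p′ , q′) =
    +ᴿ-cong (*ᴿ-cong p p′) (-ᴿ-cong (*ᴿ-cong q q′)) ,
    +ᴿ-cong (*ᴿ-cong p q′) (*ᴿ-cong q p′)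

  *ᶜ-assoc : ∀ z w u → (z *ᶜ w) *ᶜ u ≈ᶜ z *ᶜ (w *ᶜ u)
  *ᶜ-assoc z w u =
    pointwise (λ n → *-assoc-re (reₙ z n) (imₙ z n) (reₙ w n) (imₙ w n) (reₙ u n) (imₙ u n)) ,
    pointwise (λ n → *-assoc-im (reₙ z n) (imₙ z n) (reₙ w n) (imₙ w n) (reₙ u n) (imₙ u n))

  *ᶜ-comm : ∀ z w → z *ᶜ w ≈ᶜ w *ᶜ z
  *ᶜ-comm z w =
    pointwise (λ n → *-comm-re (reₙ z n) (imₙ z n) (reₙ w n) (imₙ w n)) ,
    pointwise (λ n → *-comm-im (reₙ z n) (imₙ z n) (reₙ w n) (imₙ w n))

  *ᶜ-identityˡ : ∀ z → fromℚ 1ℚ *ᶜ z ≈ᶜ z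
  *ᶜ-identityˡ z =
    pointwise (λ n → *-identity-re (reₙ z n) (imₙ z n)) ,
    pointwise (λ n → *-identity-im (reₙ z n) (imₙ z n))

  *ᶜ-distribˡ-+ᶜ : ∀ z w u → z *ᶜ (w +ᶜ u) ≈ᶜ z *ᶜ w +ᶜ z *ᶜ u
  *ᶜ-distribˡ-+ᶜ z w u =
    pointwise (λ n → distrib-re (reₙ z n) (imₙ z n) (reₙ w n) (imₙ w n) (reₙ u n) (imₙ u n)) ,
    pointwise (λ n → distrib-im (reₙ z n) (imₙ z n) (reₙ w n) (imₙ w n) (reₙ u n) (imₙ u n))

  *ᶜ-distribʳ-+ᶜ : ∀ z w u → (w +ᶜ u) *ᶜ z ≈ᶜ w *ᶜ z +ᶜ u *ᶜ z
  *ᶜ-distribʳ-+ᶜ z w u = ≈ᶜ-trans (*ᶜ-comm (w +ᶜ u) z)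
    (≈ᶜ-trans (*ᶜ-distribˡ-+ᶜ z w u) (+ᶜ-cong (*ᶜ-comm z w) (*ᶜ-comm z u)))

ℂ-commutativeRing : CommutativeRing 0ℓ 0ℓ
ℂ-commutativeRing = record
  { Carrier = ℂ ; _≈_ = _≈ᶜ_ ; _+_ = _+ᶜ_ ; _*_ = _*ᶜ_ ; -_ = -ᶜ_
  ; 0# = fromℚ 0ℚ ; 1# = fromℚ 1ℚ
  ; isCommutativeRing = record
    { isRing = record
      { +-isAbelianGroup = record
        { isGroup = record
          { isMonoid = record
            { isSemigroup = record
              { isMagma = record { isEquivalence = ≈ᶜ-isEquivalence ; ∙-cong = +ᶜ-cong }
              ; assoc = λ z w u → +ᴿ-assoc (re z) (re w) (re u) , +ᴿ-assoc (im z) (im w) (im u)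
              }
            ; identity = (λ z → +ᴿ-identityˡ (re z) , +ᴿ-identityˡ (im z))
                       , (λ z → +ᴿ-identityʳ (re z) , +ᴿ-identityʳ (im z))
            }
          ; inverse = (λ z → -ᴿ-inverseˡ (re z) , -ᴿ-inverseˡ (im z))
                    , (λ z → -ᴿ-inverseʳ (re z) , -ᴿ-inverseʳ (im z))
          ; ⁻¹-cong = -ᶜ-cong
          }
        ; comm = λ z w → +ᴿ-comm (re z) (re w) , +ᴿ-comm (im z) (im w)
        }
      ; *-cong = *ᶜ-cong
      ; *-assoc = *ᶜ-assoc
      ; *-identity = *ᶜ-identityˡ , λ z → ≈ᶜ-trans (*ᶜ-comm z (fromℚ 1ℚ)) (*ᶜ-identityˡ z)
      ; distrib = *ᶜ-distribˡ-+ᶜ , *ᶜ-distribʳ-+ᶜ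
      }
    ; *-comm = *ᶜ-comm
    }
  }

module ℂᵣ = CommutativeRing ℂ-commutativeRing

open RawSemiringDefs (Semiring.rawSemiring ℂᵣ.semiring) public using () renaming (sum to Σᶜ)

-- Σ[1≤i< l ] f  is  f 1 + … + f (l - 1).
Σ[1≤i<_] : ℕ → (ℕ → ℂ) → ℂ
Σ[1≤i< l ] f = Σᶜ {l ℕ.∸ 1} (λ i → f (suc (toℕ i)))

record FiniteField (q : ℕ) c ℓ : Set (lsuc (c ⊔ ℓ)) where
  field
    commutativeRing : CommutativeRing c ℓ

  open CommutativeRing commutativeRing public

  field
    0≉1         : ¬ (0# ≈ 1#)
    inverse     : ∀ x → ¬ (x ≈ 0#) → ∃ λ y → x * y ≈ 1#
    enumeration : Inverse setoid (≡.setoid (Fin q))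

  open RawSemiringDefs (Semiring.rawSemiring semiring) public using (_^_) renaming (_×_ to _times_)

  infix 4 _≟_

  _≟_ : Decidable _≈_
  _≟_ = via-injection (Inverse⇒Injection enumeration) Fin._≟_

  element : Fin q → Carrier
  element = Inverse.from enumeration

  elements : List Carrier
  elements = List.map element (allFin q)

  -- Total inversion, with 0⁻¹ = 0.
  infix 8 _⁻¹

  _⁻¹ : Carrier → Carrier
  x ⁻¹ with x ≟ 0#
  ... | yes _   = 0#
  ... | no x≉0 = proj₁ (inverse x x≉0)

  fromℤᶠ : ℤ → Carrier
  fromℤᶠ (+ n)    = n times 1#
  fromℤᶠ -[1+ n ] = - (suc n times 1#)

  -- Reduction of a rational number; meaningful when the characteristic
  -- does not divide the denominator.
  reduce : ℚ → Carrier
  reduce r = fromℤᶠ (↥ r) * (fromℤᶠ (+ (↧ₙ r))) ⁻¹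

  order-nonZero : ℕ.NonZero q
  order-nonZero = Fin.nonZeroIndex (Inverse.to enumeration 0#)

  ⁻¹-unique : ∀ {x y} → x * y ≈ 1# → y ≈ x ⁻¹
  ⁻¹-unique {x} {y} xy≈1 with x ≟ 0#
  ... | yes x≈0 = contradiction
        (trans (sym (zeroˡ y)) (trans (*-congʳ (sym x≈0)) xy≈1)) 0≉1
  ... | no x≉0 = begin
        y              ≈⟨ *-identityʳ y ⟨
        y * 1#         ≈⟨ *-congˡ xz≈1 ⟨
        y * (x * z)    ≈⟨ *-assoc y x z ⟨
        (y * x) * z    ≈⟨ *-congʳ (trans (*-comm y x) xy≈1) ⟩
        1# * z         ≈⟨ *-identityˡ z ⟩
        z              ∎
    where
    z = proj₁ (inverse x x≉0)
    xz≈1 = proj₂ (inverse x x≉0)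
    open SetoidReasoning setoid

  ⁻¹-inverseʳ : ∀ {x} → ¬ (x ≈ 0#) → x * x ⁻¹ ≈ 1#
  ⁻¹-inverseʳ {x} x≉0 with x ≟ 0#
  ... | yes x≈0 = contradiction x≈0 x≉0
  ... | no x≉0′ = proj₂ (inverse x x≉0′)

  ⁻¹-zero : ∀ {x} → x ≈ 0# → x ⁻¹ ≈ 0#
  ⁻¹-zero {x} x≈0 with x ≟ 0#
  ... | yes _   = refl
  ... | no x≉0 = contradiction x≈0 x≉0

  ⁻¹-cong : ∀ {x y} → x ≈ y → x ⁻¹ ≈ y ⁻¹
  ⁻¹-cong {x} {y} x≈y = aux (x ≟ 0#)
    where
    aux : Dec (x ≈ 0#) → x ⁻¹ ≈ y ⁻¹
    aux (yes x≈0) = trans (⁻¹-zero x≈0) (sym (⁻¹-zero (trans (sym x≈y) x≈0)))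
    aux (no x≉0)  = ⁻¹-unique (trans (*-congʳ (sym x≈y)) (⁻¹-inverseʳ x≉0))

  *-nonZero : ∀ {x y} → ¬ (x ≈ 0#) → ¬ (y ≈ 0#) → ¬ (x * y ≈ 0#)
  *-nonZero {x} {y} x≉0 y≉0 xy≈0 = y≉0 (begin
    y                  ≈⟨ *-identityʳ y ⟨
    y * 1#             ≈⟨ *-congˡ (⁻¹-inverseʳ x≉0) ⟨
    y * (x * x ⁻¹)     ≈⟨ *-assoc y x (x ⁻¹) ⟨
    (y * x) * x ⁻¹     ≈⟨ *-congʳ (trans (*-comm y x) xy≈0) ⟩
    0# * x ⁻¹          ≈⟨ zeroˡ (x ⁻¹) ⟩
    0#                 ∎)
    where open SetoidReasoning setoid

  ⁻¹-distrib-* : ∀ x y → (x * y) ⁻¹ ≈ x ⁻¹ * y ⁻¹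
  ⁻¹-distrib-* x y = aux (x ≟ 0#) (y ≟ 0#)
    where
    open SetoidReasoning setoid

    aux : Dec (x ≈ 0#) → Dec (y ≈ 0#) → (x * y) ⁻¹ ≈ x ⁻¹ * y ⁻¹
    aux (yes x≈0) _ = trans (⁻¹-zero (trans (*-congʳ x≈0) (zeroˡ y)))
                            (sym (trans (*-congʳ (⁻¹-zero x≈0)) (zeroˡ (y ⁻¹))))
    aux (no _) (yes y≈0) = trans (⁻¹-zero (trans (*-congˡ y≈0) (zeroʳ x)))
                                 (sym (trans (*-congˡ (⁻¹-zero y≈0)) (zeroʳ (x ⁻¹))))
    aux (no x≉0) (no y≉0) = sym (⁻¹-unique (begin
      (x * y) * (x ⁻¹ * y ⁻¹)    ≈⟨ *-assoc x y _ ⟩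
      x * (y * (x ⁻¹ * y ⁻¹))    ≈⟨ *-congˡ (*-assoc y (x ⁻¹) (y ⁻¹)) ⟨
      x * ((y * x ⁻¹) * y ⁻¹)    ≈⟨ *-congˡ (*-congʳ (*-comm y (x ⁻¹))) ⟩
      x * ((x ⁻¹ * y) * y ⁻¹)    ≈⟨ *-congˡ (*-assoc (x ⁻¹) y (y ⁻¹)) ⟩
      x * (x ⁻¹ * (y * y ⁻¹))    ≈⟨ *-assoc x (x ⁻¹) _ ⟨
      (x * x ⁻¹) * (y * y ⁻¹)    ≈⟨ *-cong (⁻¹-inverseʳ x≉0) (⁻¹-inverseʳ y≉0) ⟩
      1# * 1#                    ≈⟨ *-identityˡ 1# ⟩
      1#                         ∎))

module Characters {q} (F : FiniteField q c ℓ) where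

  open FiniteField F

  -- A homomorphism F^× → ℂ^×, extended by 0 ↦ 0.  Values at x ≉ 0 are
  -- automatically invertible, since χ x · χ x⁻¹ ≈ χ 1 ≈ 1.
  record Character : Set (c ⊔ ℓ) where
    field
      ⟦_⟧                  : Carrier → ℂ
      isMonoidHomomorphism : IsMonoidHomomorphism (Monoid.rawMonoid *-monoid) (Monoid.rawMonoid ℂᵣ.*-monoid) ⟦_⟧
      ⟦0⟧≈0                : ⟦ 0# ⟧ ℂᵣ.≈ ℂᵣ.0#

    open IsMonoidHomomorphism isMonoidHomomorphism public
      using (ε-homo; homo; ⟦⟧-cong)

  open Character public using (⟦_⟧)

  trivialValue : Carrier → ℂ
  trivialValue x with x ≟ 0#
  ... | yes _ = ℂᵣ.0#
  ... | no _  = ℂᵣ.1#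

  trivialValue-zero : ∀ {x} → x ≈ 0# → trivialValue x ℂᵣ.≈ ℂᵣ.0#
  trivialValue-zero {x} x≈0 with x ≟ 0#
  ... | yes _   = ℂᵣ.refl
  ... | no x≉0 = contradiction x≈0 x≉0

  trivialValue-nonZero : ∀ {x} → ¬ (x ≈ 0#) → trivialValue x ℂᵣ.≈ ℂᵣ.1#
  trivialValue-nonZero {x} x≉0 with x ≟ 0#
  ... | yes x≈0 = contradiction x≈0 x≉0
  ... | no _     = ℂᵣ.refl

  private
    mkCharacter : (f : Carrier → ℂ) → (∀ {x y} → x ≈ y → f x ℂᵣ.≈ f y) →
                  (∀ x y → f (x * y) ℂᵣ.≈ f x ℂᵣ.* f y) →
                  f 1# ℂᵣ.≈ ℂᵣ.1# → f 0# ℂᵣ.≈ ℂᵣ.0# → Character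
    mkCharacter f f-cong f-* f-1 f-0 = record
      { ⟦_⟧ = f
      ; isMonoidHomomorphism = record
        { isMagmaHomomorphism = record
          { isRelHomomorphism = record { cong = f-cong } ; homo = f-* }
        ; ε-homo = f-1
        }
      ; ⟦0⟧≈0 = f-0
      }

    trivialValue-cong : ∀ {x y} → x ≈ y → trivialValue x ℂᵣ.≈ trivialValue y
    trivialValue-cong {x} {y} x≈y = aux (x ≟ 0#)
      where
      aux : Dec (x ≈ 0#) → trivialValue x ℂᵣ.≈ trivialValue y
      aux (yes x≈0) = ℂᵣ.trans (trivialValue-zero x≈0)
        (ℂᵣ.sym (trivialValue-zero (trans (sym x≈y) x≈0)))
      aux (no x≉0)  = ℂᵣ.trans (trivialValue-nonZero x≉0)
        (ℂᵣ.sym (trivialValue-nonZero (λ y≈0 → x≉0 (trans x≈y y≈0))))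

    trivialValue-* : ∀ x y → trivialValue (x * y) ℂᵣ.≈ trivialValue x ℂᵣ.* trivialValue y
    trivialValue-* x y = aux (x ≟ 0#) (y ≟ 0#)
      where
      aux : Dec (x ≈ 0#) → Dec (y ≈ 0#) →
            trivialValue (x * y) ℂᵣ.≈ trivialValue x ℂᵣ.* trivialValue y
      aux (yes x≈0) _ = ℂᵣ.trans (trivialValue-zero (trans (*-congʳ x≈0) (zeroˡ y)))
        (ℂᵣ.sym (ℂᵣ.trans (ℂᵣ.*-congʳ (trivialValue-zero x≈0)) (ℂᵣ.zeroˡ _)))
      aux (no _) (yes y≈0) = ℂᵣ.trans (trivialValue-zero (trans (*-congˡ y≈0) (zeroʳ x)))
        (ℂᵣ.sym (ℂᵣ.trans (ℂᵣ.*-congˡ (trivialValue-zero y≈0)) (ℂᵣ.zeroʳ _)))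
      aux (no x≉0) (no y≉0) = ℂᵣ.trans (trivialValue-nonZero (*-nonZero x≉0 y≉0))
        (ℂᵣ.sym (ℂᵣ.trans (ℂᵣ.*-cong (trivialValue-nonZero x≉0) (trivialValue-nonZero y≉0))
                        (ℂᵣ.*-identityˡ ℂᵣ.1#)))

    interchange : ∀ u v w z → (u ℂᵣ.* v) ℂᵣ.* (w ℂᵣ.* z) ℂᵣ.≈ (u ℂᵣ.* w) ℂᵣ.* (v ℂᵣ.* z)
    interchange u v w z = begin
      (u ℂᵣ.* v) ℂᵣ.* (w ℂᵣ.* z)    ≈⟨ ℂᵣ.*-assoc u v _ ⟩
      u ℂᵣ.* (v ℂᵣ.* (w ℂᵣ.* z))    ≈⟨ ℂᵣ.*-congˡ (ℂᵣ.*-assoc v w z) ⟨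
      u ℂᵣ.* ((v ℂᵣ.* w) ℂᵣ.* z)    ≈⟨ ℂᵣ.*-congˡ (ℂᵣ.*-congʳ (ℂᵣ.*-comm v w)) ⟩
      u ℂᵣ.* ((w ℂᵣ.* v) ℂᵣ.* z)    ≈⟨ ℂᵣ.*-congˡ (ℂᵣ.*-assoc w v z) ⟩
      u ℂᵣ.* (w ℂᵣ.* (v ℂᵣ.* z))    ≈⟨ ℂᵣ.*-assoc u w _ ⟨
      (u ℂᵣ.* w) ℂᵣ.* (v ℂᵣ.* z)    ∎
      where open SetoidReasoning ℂᵣ.setoid

    value-nonZero : ∀ {x} → ¬ (x ≈ 0#) → ∀ (χ : Character) → ⟦ χ ⟧ (x * x ⁻¹) ℂᵣ.≈ ℂᵣ.1#
    value-nonZero x≉0 χ = ℂᵣ.trans (Character.⟦⟧-cong χ (⁻¹-inverseʳ x≉0)) (Character.ε-homo χ)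

    value-zero : ∀ {x} → x ≈ 0# → ∀ (χ : Character) → ⟦ χ ⟧ x ℂᵣ.≈ ℂᵣ.0#
    value-zero x≈0 χ = ℂᵣ.trans (Character.⟦⟧-cong χ x≈0) (Character.⟦0⟧≈0 χ)

  infix  4 _≈ᵡ_
  infixl 7 _·_

  _≈ᵡ_ : Rel Character c
  χ ≈ᵡ ψ = ∀ x → ⟦ χ ⟧ x ℂᵣ.≈ ⟦ ψ ⟧ x

  trivial : Character
  trivial = mkCharacter trivialValue trivialValue-cong trivialValue-*
    (trivialValue-nonZero (0≉1 ∘ sym)) (trivialValue-zero refl)

  _·_ : Character → Character → Character
  χ · ψ = mkCharacter (λ x → ⟦ χ ⟧ x ℂᵣ.* ⟦ ψ ⟧ x)
    (λ x≈y → ℂᵣ.*-cong (Character.⟦⟧-cong χ x≈y) (Character.⟦⟧-cong ψ x≈y))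
    (λ x y → ℂᵣ.trans (ℂᵣ.*-cong (Character.homo χ x y) (Character.homo ψ x y))
                     (interchange _ _ _ _))
    (ℂᵣ.trans (ℂᵣ.*-cong (Character.ε-homo χ) (Character.ε-homo ψ)) (ℂᵣ.*-identityˡ ℂᵣ.1#))
    (ℂᵣ.trans (ℂᵣ.*-congʳ (Character.⟦0⟧≈0 χ)) (ℂᵣ.zeroˡ _))

  infix 9 _‾

  _‾ : Character → Character
  χ ‾ = mkCharacter (λ x → ⟦ χ ⟧ (x ⁻¹))
    (λ x≈y → Character.⟦⟧-cong χ (⁻¹-cong x≈y))
    (λ x y → ℂᵣ.trans (Character.⟦⟧-cong χ (⁻¹-distrib-* x y)) (Character.homo χ (x ⁻¹) (y ⁻¹)))
    (ℂᵣ.trans (Character.⟦⟧-cong χ (sym (⁻¹-unique (*-identityˡ 1#)))) (Character.ε-homo χ))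
    (value-zero (⁻¹-zero refl) χ)

  characterGroup : AbelianGroup (c ⊔ ℓ) c
  characterGroup = record
    { Carrier = Character ; _≈_ = _≈ᵡ_ ; _∙_ = _·_ ; ε = trivial ; _⁻¹ = _‾
    ; isAbelianGroup = record
      { isGroup = record
        { isMonoid = record
          { isSemigroup = record
            { isMagma = record
              { isEquivalence = record
                { refl = λ _ → ℂᵣ.refl
                ; sym = λ p x → ℂᵣ.sym (p x)
                ; trans = λ p r x → ℂᵣ.trans (p x) (r x)
                }
              ; ∙-cong = λ p r x → ℂᵣ.*-cong (p x) (r x)
              }
            ; assoc = λ χ ψ φ x → ℂᵣ.*-assoc (⟦ χ ⟧ x) (⟦ ψ ⟧ x) (⟦ φ ⟧ x)
            }
          ; identity = identityˡ , λ χ x → ℂᵣ.trans (ℂᵣ.*-comm (⟦ χ ⟧ x) _) (identityˡ χ x)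
          }
        ; inverse = (λ χ x → ℂᵣ.trans (ℂᵣ.*-comm (⟦ χ ‾ ⟧ x) _) (inverseʳ χ x)) , inverseʳ
        ; ⁻¹-cong = λ p x → p (x ⁻¹)
        }
      ; comm = λ χ ψ x → ℂᵣ.*-comm (⟦ χ ⟧ x) (⟦ ψ ⟧ x)
      }
    }
    where
    identityˡ : ∀ χ → (trivial · χ) ≈ᵡ χ
    identityˡ χ x = aux (x ≟ 0#)
      where
      aux : Dec (x ≈ 0#) → trivialValue x ℂᵣ.* ⟦ χ ⟧ x ℂᵣ.≈ ⟦ χ ⟧ x
      aux (yes x≈0) = ℂᵣ.trans (ℂᵣ.*-congˡ (value-zero x≈0 χ))
        (ℂᵣ.trans (ℂᵣ.zeroʳ _) (ℂᵣ.sym (value-zero x≈0 χ)))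
      aux (no x≉0)  = ℂᵣ.trans (ℂᵣ.*-congʳ (trivialValue-nonZero x≉0)) (ℂᵣ.*-identityˡ _)

    inverseʳ : ∀ χ → (χ · χ ‾) ≈ᵡ trivial
    inverseʳ χ x = aux (x ≟ 0#)
      where
      aux : Dec (x ≈ 0#) → ⟦ χ ⟧ x ℂᵣ.* ⟦ χ ⟧ (x ⁻¹) ℂᵣ.≈ trivialValue x
      aux (yes x≈0) = ℂᵣ.trans (ℂᵣ.*-congʳ (value-zero x≈0 χ))
        (ℂᵣ.trans (ℂᵣ.zeroˡ _) (ℂᵣ.sym (trivialValue-zero x≈0)))
      aux (no x≉0)  = ℂᵣ.trans (ℂᵣ.sym (Character.homo χ x (x ⁻¹)))
        (ℂᵣ.trans (value-nonZero x≉0 χ) (ℂᵣ.sym (trivialValue-nonZero x≉0)))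

  infixr 8 _^ᵡ_

  _^ᵡ_ : Character → ℕ → Character
  χ ^ᵡ n = RawMonoidDefs._×_ (AbelianGroup.rawMonoid characterGroup) n χ

  CharacterOfOrder : ℕ → Character → Set c
  CharacterOfOrder n χ = HasOrder (AbelianGroup.group characterGroup) χ n

  1/q : ℂ
  1/q = fromℚ (ℚ._/_ (+ 1) q {{order-nonZero}})

  binom : Character → Character → ℂ
  binom A B = (⟦ B ⟧ (- 1#) ℂᵣ.* 1/q) ℂᵣ.* Σᶜ (λ i → term (element i))
    where
    term : Carrier → ℂ
    term x = ⟦ A ⟧ x ℂᵣ.* ⟦ B ‾ ⟧ (1# - x)

module Curve {q} (F : FiniteField q c ℓ) (l : ℕ) (λ₀ : ℚ) where

  open FiniteField F

  OnCurve : Carrier × Carrier → Set ℓ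
  OnCurve (x , y) = y ^ l ≈ (x - 1#) * (x ^ 2 + reduce λ₀)

  onCurve? : ∀ P → Dec (OnCurve P)
  onCurve? (x , y) = (y ^ l) ≟ ((x - 1#) * (x ^ 2 + reduce λ₀))

  #affinePoints : ℕ
  #affinePoints = length (filter onCurve? (cartesianProduct elements elements))

  -- The convention taken for #C(𝔽_q): one point at infinity unless l = 3,
  -- and three if l = 3, which presupposes q ≡ 1 (mod 3).
  #pointsAtInfinity : ℕ
  #pointsAtInfinity = if does (l ℕ.≟ 3) then 3 else 1

  #points : ℕ
  #points = #pointsAtInfinity ℕ.+ #affinePoints

  a-q : ℤ
  a-q = ((+ 1) ℤ.+ (+ q)) ℤ.- (+ #points)

{-# OPTIONS --safe #-}
module Submission where

-- With t = 1/3 and s = 2/3 the substitution x = s v + t depresses the cubic: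
-- (x - 1)(x² + t) = s³ (v³ - 1).  If q ≡ 2 (mod 3), cubing permutes 𝔽_q, so every
-- y lies over exactly one x.  Otherwise both y ↦ yˡ and v ↦ v³ are counted with
-- characters, #{y : yˡ = z} = 1 + Σ_{0<i<l} Sⁱ(z), and Σ_w Sⁱ(w - 1) = 0 leaves the
-- Jacobi sums of χ₃ and χ₃² with Sⁱ; the formula is stated for the inverse
-- characters, so the count is made with S‾, which also has order l.
--
-- The character count needs no generator of 𝔽_q^×: the number of roots of yˡ = z is
-- at most the character sum, pointwise, and both add up to q over all z.

open import Defs
open import Level using (Level)
open import Algebra.Bundles using (AbelianGroup; CommutativeMonoid; CommutativeRing)
import Algebra.Properties.CommutativeMonoid.Sum as CommutativeMonoidSum
import Algebra.Properties.Monoid.Mult as MonoidMult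
import Algebra.Properties.Semiring.Exp as SemiringExp
import Algebra.Properties.Semiring.Mult as SemiringMult
import Algebra.Properties.Semiring.Sum as SemiringSum
open import Data.Bool.Base using (if_then_else_; true; false)
open import Data.Fin.Base using (Fin; zero; suc; toℕ)
open import Data.Fin.Permutation using (permutation)
import Data.Fin.Properties as Fin
open import Data.Integer.Base as ℤ using (+_)
import Data.Integer.Properties as ℤ
open import Data.List.Base as List using (_++_; cartesianProduct; filter; length; tabulate)
import Data.List.Properties as List
open import Data.Nat.Base as ℕ using (ℕ; zero; suc; z≤n; s≤s)
import Data.Nat.Coprimality as Coprime
open import Data.Nat.Coprimality using (Coprime)
open import Data.Nat.Divisibility as ℕ using (divides)
open import Data.Nat.GCD using (module Bézout)
open import Data.Nat.Primality using (Prime; prime⇒nonTrivial)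
import Data.Nat.Properties as ℕ
import Data.Nat.Solver as ℕ
open import Data.Product.Base using (_×_; _,_; proj₁; proj₂; ∃)
open import Data.Rational.Base as ℚ using (ℚ; 0ℚ; 1ℚ; ½; _/_)
import Data.Rational.Properties as ℚ
import Data.Rational.Solver as ℚ
import Data.Rational.Unnormalised.Base as ℚᵘ
import Data.Rational.Unnormalised.Properties as ℚᵘ
open import Data.Sum.Base as Sum using (_⊎_; fromInj₁; inj₁; inj₂; [_,_]′)
open import Data.Vec.Base as Vec using (Vec; []; _∷_)
open import Function.Base using (_∘_; id)
open import Function.Bundles using (Inverse)
open import Relation.Binary.PropositionalEquality as ≡ using (_≡_; _≢_)
import Relation.Binary.Reasoning.Setoid as SetoidReasoning
open import Relation.Nullary using (¬_; Dec; yes; no; does; contradiction)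
open import Relation.Nullary.Decidable using (dec-false; decidable-stable; from-no)

open SemiringExp ℂᵣ.semiring using () renaming (_^_ to _^ᶜ_; ^-congˡ to ^ᶜ-congˡ; ^-assocʳ to ^ᶜ-assocʳ)
open SemiringSum ℂᵣ.semiring using () renaming
  (sum-cong-≋ to Σᶜ-cong; ∑-distrib-+ to Σᶜ-+; ∑-comm to Σᶜ-comm;
   *-distribˡ-sum to *-distribˡ-Σᶜ; *-distribʳ-sum to *-distribʳ-Σᶜ)
open SemiringSum ℕ.+-*-semiring using () renaming
  (sum to Σᴺ; sum-cong-≗ to Σᴺ-cong; ∑-distrib-+ to Σᴺ-+; ∑-comm to Σᴺ-comm)

-- The shift of x by 1/3 removes the square term of x³ - x² + λx - λ and leaves the linear
-- coefficient λ - 1/3, so λ = 1/3 is exactly the value at which the cubic becomes w³ - 8/27. As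
-- 8/27 = (2/3)³, scaling gives v³ - 1, and the argument 27/8 in the formula is the inverse of the
-- factor split off.
--
-- The obstacle is constructive: there is no case split on χ(z) = 1 between Cauchy reals. For ω with
-- ωⁿ = 1 one still gets the alternative "ω = 1 or 1 + ω + ... + ωⁿ⁻¹ = 0", because a complex
-- idempotent is provably 0 or 1. The vanishing geometric sum then does the work of ω ≠ 1, both for
-- orthogonality and for the count of roots.
--
-- The pointwise bound holds since yⁿ - z has at most n roots, while χ(z) = 1 for every non-zero
-- n-th power z. It is a bound by natural numbers, and the equality of totals is brought back from ℂ
-- to ℕ.

module ℝᵣ = CommutativeRing ℝ-commutativeRing

-- The embeddings of ℕ, ℤ and ℚ into ℂ

/1-+ : ∀ i j → (i ℤ.+ j) ℚ./ 1 ≡ i ℚ./ 1 ℚ.+ j ℚ./ 1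
/1-+ i j = ℚ.toℚᵘ-injective (begin
  ℚ.toℚᵘ ((i ℤ.+ j) ℚ./ 1)                    ≈⟨ to/1 (i ℤ.+ j) ⟩
  ℚᵘ.mkℚᵘ (i ℤ.+ j) 0                         ≈⟨ ℚᵘ.*≡* (≡.cong (ℤ._* + 1) (≡.sym (≡.cong₂ ℤ._+_ (ℤ.*-identityʳ i) (ℤ.*-identityʳ j)))) ⟩
  ℚᵘ.mkℚᵘ i 0 ℚᵘ.+ ℚᵘ.mkℚᵘ j 0                ≈⟨ ℚᵘ.+-cong (to/1 i) (to/1 j) ⟨
  ℚ.toℚᵘ (i ℚ./ 1) ℚᵘ.+ ℚ.toℚᵘ (j ℚ./ 1)      ≈⟨ ℚ.toℚᵘ-homo-+ (i ℚ./ 1) (j ℚ./ 1) ⟨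
  ℚ.toℚᵘ (i ℚ./ 1 ℚ.+ j ℚ./ 1)                ∎)
  where
  open SetoidReasoning ℚᵘ.≃-setoid
  to/1 : ∀ k → ℚ.toℚᵘ (k ℚ./ 1) ℚᵘ.≃ ℚᵘ.mkℚᵘ k 0
  to/1 k = ℚ.toℚᵘ-fromℚᵘ (ℚᵘ.mkℚᵘ k 0)

/1*1/ : ∀ n .{{_ : ℕ.NonZero n}} → (+ n ℚ./ 1) ℚ.* (+ 1 ℚ./ n) ≡ 1ℚ
/1*1/ n@(suc m) = ℚ.toℚᵘ-injective (begin
  ℚ.toℚᵘ ((+ n ℚ./ 1) ℚ.* (+ 1 ℚ./ n))              ≈⟨ ℚ.toℚᵘ-homo-* (+ n ℚ./ 1) (+ 1 ℚ./ n) ⟩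
  ℚ.toℚᵘ (+ n ℚ./ 1) ℚᵘ.* ℚ.toℚᵘ (+ 1 ℚ./ n)        ≈⟨ ℚᵘ.*-cong (ℚ.toℚᵘ-fromℚᵘ (ℚᵘ.mkℚᵘ (+ n) 0)) (ℚ.toℚᵘ-fromℚᵘ (ℚᵘ.mkℚᵘ (+ 1) m)) ⟩
  ℚᵘ.mkℚᵘ (+ n) 0 ℚᵘ.* ℚᵘ.mkℚᵘ (+ 1) m              ≈⟨ ℚᵘ.*≡* (≡.cong +_ eq) ⟩
  ℚ.toℚᵘ 1ℚ                                         ∎)
  where
  open SetoidReasoning ℚᵘ.≃-setoid
  eq : (n ℕ.* 1) ℕ.* 1 ≡ 1 ℕ.* (1 ℕ.* n)
  eq = ≡.trans (ℕ.*-identityʳ (n ℕ.* 1)) (≡.trans (ℕ.*-comm n 1) (≡.sym (ℕ.*-identityˡ (1 ℕ.* n))))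

fromℚ-+ : ∀ a b → fromℚ (a ℚ.+ b) ≈ᶜ fromℚ a +ᶜ fromℚ b
fromℚ-+ a b = pointwise (λ _ → ≡.refl) , pointwise (λ _ → ≡.refl)

fromℚ-* : ∀ a b → fromℚ (a ℚ.* b) ≈ᶜ fromℚ a *ᶜ fromℚ b
fromℚ-* a b =
  pointwise (λ _ → ≡.sym (ℚ.+-identityʳ (a ℚ.* b))) ,
  pointwise (λ _ → ≡.sym (≡.cong₂ ℚ._+_ (ℚ.*-zeroʳ a) (ℚ.*-zeroˡ b)))

fromℚ-cong : ∀ {a b} → a ≡ b → fromℚ a ≈ᶜ fromℚ b
fromℚ-cong ≡.refl = ℂᵣ.refl

fromℤ-+ : ∀ i j → fromℤ (i ℤ.+ j) ≈ᶜ fromℤ i +ᶜ fromℤ j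
fromℤ-+ i j = ℂᵣ.trans (fromℚ-cong (/1-+ i j)) (fromℚ-+ (i ℚ./ 1) (j ℚ./ 1))

ι : ℕ → ℂ
ι n = fromℤ (+ n)

ι-inverse : ∀ n .{{_ : ℕ.NonZero n}} → ι n *ᶜ fromℚ (+ 1 ℚ./ n) ≈ᶜ ℂᵣ.1#
ι-inverse n = ℂᵣ.trans (ℂᵣ.sym (fromℚ-* (+ n ℚ./ 1) (+ 1 ℚ./ n))) (fromℚ-cong (/1*1/ n))

ι-cancel : ∀ n .{{_ : ℕ.NonZero n}} {z w} → ι n *ᶜ z ≈ᶜ ι n *ᶜ w → z ≈ᶜ w
ι-cancel n {z} {w} eq = begin
  z                    ≈⟨ ℂᵣ.*-identityˡ z ⟨
  ℂᵣ.1# *ᶜ z           ≈⟨ ℂᵣ.*-congʳ i·ι ⟨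
  (i *ᶜ ι n) *ᶜ z      ≈⟨ ℂᵣ.*-assoc i (ι n) z ⟩
  i *ᶜ (ι n *ᶜ z)      ≈⟨ ℂᵣ.*-congˡ eq ⟩
  i *ᶜ (ι n *ᶜ w)      ≈⟨ ℂᵣ.*-assoc i (ι n) w ⟨
  (i *ᶜ ι n) *ᶜ w      ≈⟨ ℂᵣ.*-congʳ i·ι ⟩
  ℂᵣ.1# *ᶜ w           ≈⟨ ℂᵣ.*-identityˡ w ⟩
  w                    ∎
  where
  open SetoidReasoning ℂᵣ.setoid
  i = fromℚ (+ 1 ℚ./ n)
  i·ι : i *ᶜ ι n ≈ᶜ ℂᵣ.1#
  i·ι = ℂᵣ.trans (ℂᵣ.*-comm i (ι n)) (ι-inverse n)

ι-+ : ∀ m n → ι (m ℕ.+ n) ≈ᶜ ι m +ᶜ ι n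
ι-+ m n = fromℤ-+ (+ m) (+ n)

ι-suc : ∀ n → ι (suc n) ≈ᶜ ℂᵣ.1# +ᶜ ι n
ι-suc n = ι-+ 1 n

-- The null condition, tested at ε = |r|, would give |r| < |r| if |r| were positive.
constant-null : ∀ r → fromℚᴿ r ≈ᴿ fromℚᴿ 0ℚ → r ≡ 0ℚ
constant-null r (mk≈ᴿ null) = ℚ.∣p∣≡0⇒p≡0 r (ℚ.≤-antisym (ℚ.≮⇒≥ not-positive) (ℚ.0≤∣p∣ r))
  where
  not-positive : ¬ (0ℚ ℚ.< ℚ.∣ r ∣)
  not-positive ∣r∣>0 with null ℚ.∣ r ∣ ∣r∣>0
  ... | N , h = ℚ.<-irrefl (≡.cong ℚ.∣_∣ (ℚ.+-identityʳ r)) (h N ℕ.≤-refl)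

/1≢0 : ∀ n → ¬ ((+ suc n) ℚ./ 1 ≡ 0ℚ)
/1≢0 n eq = ℚ.1≢0 (≡.trans (≡.sym (/1*1/ (suc n)))
  (≡.trans (≡.cong (ℚ._* (+ 1 ℚ./ suc n)) eq) (ℚ.*-zeroˡ (+ 1 ℚ./ suc n))))

-- Brings equalities proved with characters in ℂ back to ℕ, where counts can be compared.
ι-injective : ∀ m n → ι m ≈ᶜ ι n → m ≡ n
ι-injective zero    zero    _       = ≡.refl
ι-injective zero    (suc n) (p , _) = contradiction (constant-null _ (≈ᴿ-sym p)) (/1≢0 n)
ι-injective (suc m) zero    (p , _) = contradiction (constant-null _ p) (/1≢0 m)
ι-injective (suc m) (suc n) p       = ≡.cong suc (ι-injective m n (+-cancelˡ ℂᵣ.1# (ι m) (ι n)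
  (ℂᵣ.trans (ℂᵣ.sym (ι-suc m)) (ℂᵣ.trans p (ι-suc n)))))
  where open import Algebra.Properties.Group ℂᵣ.+-group renaming (∙-cancelˡ to +-cancelˡ)

-- Idempotents and roots of unity

¼ : ℚ
¼ = + 1 ℚ./ 4

module _ where
  open ℚ.+-*-Solver

  factor : ∀ a → a ℚ.* a ℚ.- a ≡ ℚ.- (a ℚ.* (1ℚ ℚ.- a))
  factor = solve 1 (λ a → a :* a :- a := :- (a :* (con 1ℚ :- a))) ≡.refl

  complement : ∀ a b → 1ℚ ℚ.- a ≡ (½ ℚ.- b) ℚ.+ ((¼ ℚ.- (a ℚ.- b)) ℚ.+ ¼)
  complement = solve 2 (λ a b → con 1ℚ :- a := (con ½ :- b) :+ ((con ¼ :- (a :- b)) :+ con ¼)) ≡.refl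

  complement-idem : ∀ a → (1ℚ ℚ.- a) ℚ.* (1ℚ ℚ.- a) ≡ (1ℚ ℚ.- (a ℚ.+ a)) ℚ.+ a ℚ.* a
  complement-idem = solve 1 (λ a → (con 1ℚ :- a) :* (con 1ℚ :- a) := (con 1ℚ :- (a :+ a)) :+ a :* a) ≡.refl

  double-complement : ∀ a → (1ℚ ℚ.- (a ℚ.+ a)) ℚ.+ a ≡ 1ℚ ℚ.- a
  double-complement = solve 1 (λ a → (con 1ℚ :- (a :+ a)) :+ a := con 1ℚ :- a) ≡.refl

  complement² : ∀ a → a ≡ 1ℚ ℚ.- (1ℚ ℚ.- a)
  complement² = solve 1 (λ a → a := con 1ℚ :- (con 1ℚ :- a)) ≡.refl

p-q≥0 : ∀ {p q} → q ℚ.≤ p → 0ℚ ℚ.≤ p ℚ.- q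
p-q≥0 {p} {q} q≤p = ≡.subst (ℚ._≤ p ℚ.- q) (ℚ.+-inverseʳ q) (ℚ.+-monoˡ-≤ (ℚ.- q) q≤p)

p≤∣p∣ : ∀ p → p ℚ.≤ ℚ.∣ p ∣
p≤∣p∣ p with ℚ.≤-total 0ℚ p
... | inj₁ 0≤p = ℚ.≤-reflexive (≡.sym (ℚ.0≤p⇒∣p∣≡p 0≤p))
... | inj₂ p≤0 = ℚ.≤-trans p≤0 (ℚ.0≤∣p∣ p)

-- Beyond N the terms stay below 3/4, so |1 - xₙ| ≥ 1/4. Since |xₙ| |1 - xₙ| tends to 0, so does
-- |xₙ|; this is why x² ≈ x is used at ε/4.
idempotent-near-0 : ∀ x N → x *ᴿ x ≈ᴿ x → (∀ n → N ℕ.≤ n → ℚ.∣ seq x n ℚ.- seq x N ∣ ℚ.< ¼) →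
                    seq x N ℚ.≤ ½ → x ≈ᴿ fromℚᴿ 0ℚ
idempotent-near-0 x N (mk≈ᴿ null) near xN≤½ = mk≈ᴿ λ ε ε>0 → limit ε (null (¼ ℚ.* ε) (ε/4>0 ε>0))
  where
  ε/4>0 : ∀ {ε} → 0ℚ ℚ.< ε → 0ℚ ℚ.< ¼ ℚ.* ε
  ε/4>0 {ε} ε>0 = ≡.subst (ℚ._< ¼ ℚ.* ε) (ℚ.*-zeroʳ ¼) (ℚ.*-monoʳ-<-pos ¼ ε>0)

  ¼≤1-x : ∀ n → N ℕ.≤ n → ¼ ℚ.≤ ℚ.∣ 1ℚ ℚ.- seq x n ∣
  ¼≤1-x n N≤n = begin
    ¼                                                 ≤⟨ ℚ.+-mono-≤ {0ℚ} {½ ℚ.- b} (p-q≥0 xN≤½)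
                                                           (ℚ.+-monoˡ-≤ ¼ {0ℚ} {¼ ℚ.- (a ℚ.- b)} (p-q≥0 (ℚ.≤-trans (p≤∣p∣ (a ℚ.- b)) (ℚ.<⇒≤ (near n N≤n))))) ⟩
    (½ ℚ.- b) ℚ.+ ((¼ ℚ.- (a ℚ.- b)) ℚ.+ ¼)           ≡⟨ complement a b ⟨
    1ℚ ℚ.- a                                          ≤⟨ p≤∣p∣ (1ℚ ℚ.- a) ⟩
    ℚ.∣ 1ℚ ℚ.- a ∣                                    ∎
    where
    open ℚ.≤-Reasoning
    a = seq x n
    b = seq x N

  limit : ∀ ε → (∃ λ M → ∀ n → M ℕ.≤ n → ℚ.∣ seq x n ℚ.* seq x n ℚ.- seq x n ∣ ℚ.< ¼ ℚ.* ε) →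
          ∃ λ M → ∀ n → M ℕ.≤ n → ℚ.∣ seq x n ℚ.- 0ℚ ∣ ℚ.< ε
  limit ε (M , h) = M ℕ.⊔ N , λ n M⊔N≤n → ℚ.*-cancelˡ-<-nonNeg ¼ (begin-strict
    ¼ ℚ.* ℚ.∣ seq x n ℚ.- 0ℚ ∣                     ≡⟨ ≡.cong (λ z → ¼ ℚ.* ℚ.∣ z ∣) (ℚ.+-identityʳ (seq x n)) ⟩
    ¼ ℚ.* ℚ.∣ seq x n ∣                            ≤⟨ ℚ.*-monoʳ-≤-nonNeg ℚ.∣ seq x n ∣ {{ℚ.∣-∣-nonNeg (seq x n)}} (¼≤1-x n (ℕ.≤-trans (ℕ.m≤n⊔m M N) M⊔N≤n)) ⟩
    ℚ.∣ 1ℚ ℚ.- seq x n ∣ ℚ.* ℚ.∣ seq x n ∣         ≡⟨ ℚ.*-comm ℚ.∣ 1ℚ ℚ.- seq x n ∣ ℚ.∣ seq x n ∣ ⟩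
    ℚ.∣ seq x n ∣ ℚ.* ℚ.∣ 1ℚ ℚ.- seq x n ∣         ≡⟨ ℚ.∣p*q∣≡∣p∣*∣q∣ (seq x n) (1ℚ ℚ.- seq x n) ⟨
    ℚ.∣ seq x n ℚ.* (1ℚ ℚ.- seq x n) ∣             ≡⟨ ℚ.∣-p∣≡∣p∣ (seq x n ℚ.* (1ℚ ℚ.- seq x n)) ⟨
    ℚ.∣ ℚ.- (seq x n ℚ.* (1ℚ ℚ.- seq x n)) ∣       ≡⟨ ≡.cong ℚ.∣_∣ (factor (seq x n)) ⟨
    ℚ.∣ seq x n ℚ.* seq x n ℚ.- seq x n ∣          <⟨ h n (ℕ.≤-trans (ℕ.m≤m⊔n M N) M⊔N≤n) ⟩
    ¼ ℚ.* ε                                        ∎)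
    where open ℚ.≤-Reasoning

-- The order of ℚ is decidable, and one term x_N beyond the modulus for 1/4 settles the alternative:
-- it lies on one side of 1/2. The upper side reduces to the lower one for the idempotent 1 - x.
idempotentᴿ : ∀ x → x *ᴿ x ≈ᴿ x → x ≈ᴿ fromℚᴿ 0ℚ ⊎ x ≈ᴿ fromℚᴿ 1ℚ
idempotentᴿ x xx≈x with ℝ.cauchy x ¼ (ℚ.positive⁻¹ ¼)
... | N , close with ℚ.≤-total (seq x N) ½
...   | inj₁ xN≤½ = inj₁ (idempotent-near-0 x N xx≈x (λ n N≤n → close n N N≤n ℕ.≤-refl) xN≤½)
...   | inj₂ ½≤xN = inj₂ (begin
  x                        ≈⟨ pointwise {x} {1ᴿ +ᴿ -ᴿ (1ᴿ +ᴿ -ᴿ x)} (λ n → complement² (seq x n)) ⟩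
  1ᴿ +ᴿ -ᴿ y               ≈⟨ ℝᵣ.+-congˡ (ℝᵣ.-‿cong y≈0) ⟩
  1ᴿ +ᴿ -ᴿ fromℚᴿ 0ℚ       ≈⟨ pointwise (λ _ → ≡.refl) ⟩
  1ᴿ                       ∎)
  where
  open SetoidReasoning ℝᵣ.setoid
  1ᴿ = fromℚᴿ 1ℚ
  y = 1ᴿ +ᴿ -ᴿ x

  yy≈y : y *ᴿ y ≈ᴿ y
  yy≈y = begin
    y *ᴿ y                             ≈⟨ pointwise {y *ᴿ y} {(1ᴿ +ᴿ -ᴿ (x +ᴿ x)) +ᴿ x *ᴿ x} (λ n → complement-idem (seq x n)) ⟩
    (1ᴿ +ᴿ -ᴿ (x +ᴿ x)) +ᴿ x *ᴿ x      ≈⟨ ℝᵣ.+-congˡ xx≈x ⟩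
    (1ᴿ +ᴿ -ᴿ (x +ᴿ x)) +ᴿ x           ≈⟨ pointwise {(1ᴿ +ᴿ -ᴿ (x +ᴿ x)) +ᴿ x} {y} (λ n → double-complement (seq x n)) ⟩
    y                                  ∎

  y-close : ∀ n → N ℕ.≤ n → ℚ.∣ (1ℚ ℚ.- seq x n) ℚ.- (1ℚ ℚ.- seq x N) ∣ ℚ.< ¼
  y-close n N≤n = ≡.subst (ℚ._< ¼) (≡.cong ℚ.∣_∣ (flip (seq x n) (seq x N))) (close N n ℕ.≤-refl N≤n)
    where
    open ℚ.+-*-Solver
    flip : ∀ a b → b ℚ.- a ≡ (1ℚ ℚ.- a) ℚ.- (1ℚ ℚ.- b)
    flip = solve 2 (λ a b → b :- a := (con 1ℚ :- a) :- (con 1ℚ :- b)) ≡.refl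

  y≈0 : y ≈ᴿ fromℚᴿ 0ℚ
  y≈0 = idempotent-near-0 y N yy≈y y-close (ℚ.+-monoʳ-≤ 1ℚ (ℚ.neg-antimono-≤ ½≤xN))

p*p≥0 : ∀ p → 0ℚ ℚ.≤ p ℚ.* p
p*p≥0 p = ≡.subst (0ℚ ℚ.≤_) ∣p*p∣≡p*p (ℚ.0≤∣p∣ (p ℚ.* p))
  where
  ∣p*p∣≡p*p : ℚ.∣ p ℚ.* p ∣ ≡ p ℚ.* p
  ∣p*p∣≡p*p with ℚ.∣p∣≡p∨∣p∣≡-p p
  ... | inj₁ eq = ≡.trans (ℚ.∣p*q∣≡∣p∣*∣q∣ p p) (≡.cong₂ ℚ._*_ eq eq)
  ... | inj₂ eq = ≡.trans (ℚ.∣p*q∣≡∣p∣*∣q∣ p p) (≡.trans (≡.cong₂ ℚ._*_ eq eq)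
    (solve 1 (λ p → (:- p) :* (:- p) := p :* p) ≡.refl p))
    where open ℚ.+-*-Solver

-- Each rational term of -x² is at most 0, so its distance from 1 is never below ε = 1.
square-not-1 : ∀ x → ¬ (-ᴿ (x *ᴿ x) ≈ᴿ fromℚᴿ 1ℚ)
square-not-1 x (mk≈ᴿ null) with null 1ℚ (ℚ.positive⁻¹ 1ℚ)
... | N , h = ℚ.<-irrefl ≡.refl (ℚ.<-≤-trans (h N ℕ.≤-refl) (begin
  1ℚ                                         ≤⟨ ℚ.+-monoˡ-≤ 1ℚ (p*p≥0 a) ⟩
  a ℚ.* a ℚ.+ 1ℚ                             ≤⟨ p≤∣p∣ (a ℚ.* a ℚ.+ 1ℚ) ⟩
  ℚ.∣ a ℚ.* a ℚ.+ 1ℚ ∣                       ≡⟨ ℚ.∣-p∣≡∣p∣ (a ℚ.* a ℚ.+ 1ℚ) ⟨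
  ℚ.∣ ℚ.- (a ℚ.* a ℚ.+ 1ℚ) ∣                 ≡⟨ ≡.cong ℚ.∣_∣ (ℚ.neg-distrib-+ (a ℚ.* a) 1ℚ) ⟩
  ℚ.∣ ℚ.- (a ℚ.* a) ℚ.- 1ℚ ∣                 ∎))
  where
  open ℚ.≤-Reasoning
  a = seq x N

module GaussianIdempotent {c ℓ : Level} (R : CommutativeRing c ℓ) where
  open CommutativeRing R
  open SetoidReasoning setoid
  open import Algebra.Properties.Ring ring using (+-cancelˡ; -‿involutive; -‿distribˡ-*; -‿distribʳ-*; +-inverseˡ-unique)
  open import Algebra.Solver.Ring.NaturalCoefficients.Default commutativeSemiring

  module Imaginary {x y : Carrier} (xx≈x+yy : x * x ≈ x + y * y) (2xy≈y : x * y + y * x ≈ y) where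

    d : Carrier
    d = (y + y) * (y + y)

    -- Evaluate 4x²y in two ways: as 2x(2xy) it is y, and as 4(x + y²)y it is 2y + dy.
    y+dy≈0 : y + d * y ≈ 0#
    y+dy≈0 = +-cancelˡ y (y + d * y) 0# (begin
      y + (y + d * y)                       ≈⟨ +-cong 2xy≈y (+-congʳ 2xy≈y) ⟨
      (x * y + y * x) + ((x * y + y * x) + d * y)
        ≈⟨ solve 2 (λ x y → (x :* y :+ y :* x) :+ ((x :* y :+ y :* x) :+ (y :+ y) :* (y :+ y) :* y) :=
                            (x :+ y :* y) :* ((y :+ y) :+ (y :+ y))) refl x y ⟩
      (x + y * y) * ((y + y) + (y + y))            ≈⟨ *-congʳ xx≈x+yy ⟨
      (x * x) * ((y + y) + (y + y))
        ≈⟨ solve 2 (λ x y → (x :* x) :* ((y :+ y) :+ (y :+ y)) := x :* (x :* y :+ y :* x) :+ (x :* y :+ y :* x) :* x) refl x y ⟩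
      x * (x * y + y * x) + (x * y + y * x) * x  ≈⟨ +-cong (*-congˡ 2xy≈y) (*-congʳ 2xy≈y) ⟩
      x * y + y * x                         ≈⟨ 2xy≈y ⟩
      y                                     ≈⟨ +-identityʳ y ⟨
      y + 0#                                ∎)

    -- Multiplying y + dy ≈ 0 by 4y gives d + d² ≈ 0.
    -d-idempotent : - d * - d ≈ - d
    -d-idempotent = begin
      - d * - d      ≈⟨ -‿distribˡ-* d (- d) ⟨
      - (d * - d)    ≈⟨ -‿cong (-‿distribʳ-* d d) ⟨
      - - (d * d)    ≈⟨ -‿involutive (d * d) ⟩
      d * d          ≈⟨ +-inverseˡ-unique (d * d) d dd+d≈0 ⟩
      - d            ∎
      where
      dd+d≈0 : d * d + d ≈ 0#
      dd+d≈0 = begin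
        d * d + d    ≈⟨ solve 2 (λ y d → d :* ((y :+ y) :* (y :+ y)) :+ (y :+ y) :* (y :+ y) := ((y :+ y) :+ (y :+ y)) :* (y :+ d :* y)) refl y d ⟩
        ((y + y) + (y + y)) * (y + d * y)   ≈⟨ *-congˡ y+dy≈0 ⟩
        ((y + y) + (y + y)) * 0#            ≈⟨ zeroʳ _ ⟩
        0#                         ∎

-- Writing z = x + iy, idempotency says x² - y² = x and 2xy = y, whence
-- y² = -(2y²)²: the real number -(2y)² is idempotent and not positive.
idempotentᶜ : ∀ z → z *ᶜ z ≈ᶜ z → z ≈ᶜ ℂᵣ.0# ⊎ z ≈ᶜ ℂᵣ.1#
idempotentᶜ z (re≈ , im≈) = conclude (idempotentᴿ x xx≈x)
  where
  open SetoidReasoning ℝᵣ.setoid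
  open import Algebra.Properties.Group ℝᵣ.+-group using (//-rightDividesˡ)
  0ᴿ = fromℚᴿ 0ℚ
  x = re z
  y = im z

  xx≈x+yy : x *ᴿ x ≈ᴿ x +ᴿ y *ᴿ y
  xx≈x+yy = begin
    x *ᴿ x                               ≈⟨ //-rightDividesˡ (y *ᴿ y) (x *ᴿ x) ⟨
    (x *ᴿ x +ᴿ -ᴿ (y *ᴿ y)) +ᴿ y *ᴿ y    ≈⟨ ℝᵣ.+-congʳ re≈ ⟩
    x +ᴿ y *ᴿ y                          ∎

  open GaussianIdempotent.Imaginary ℝ-commutativeRing {x} {y} xx≈x+yy im≈

  -d≈0 : -ᴿ d ≈ᴿ 0ᴿ
  -d≈0 = fromInj₁ (λ eq → contradiction eq (square-not-1 (y +ᴿ y))) (idempotentᴿ (-ᴿ d) -d-idempotent)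

  d≈0 : d ≈ᴿ 0ᴿ
  d≈0 = ℝᵣ.trans (ℝᵣ.sym (-‿involutive d)) (ℝᵣ.trans (ℝᵣ.-‿cong -d≈0) -0#≈0#)
    where open import Algebra.Properties.Ring ℝᵣ.ring using (-‿involutive; -0#≈0#)

  y≈0 : y ≈ᴿ 0ᴿ
  y≈0 = begin
    y               ≈⟨ ℝᵣ.+-identityʳ y ⟨
    y +ᴿ 0ᴿ         ≈⟨ ℝᵣ.+-congˡ (ℝᵣ.trans (ℝᵣ.*-congʳ d≈0) (ℝᵣ.zeroˡ y)) ⟨
    y +ᴿ d *ᴿ y     ≈⟨ y+dy≈0 ⟩
    0ᴿ              ∎

  xx≈x : x *ᴿ x ≈ᴿ x
  xx≈x = begin
    x *ᴿ x            ≈⟨ xx≈x+yy ⟩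
    x +ᴿ y *ᴿ y       ≈⟨ ℝᵣ.+-congˡ (ℝᵣ.trans (ℝᵣ.*-congˡ y≈0) (ℝᵣ.zeroʳ y)) ⟩
    x +ᴿ 0ᴿ           ≈⟨ ℝᵣ.+-identityʳ x ⟩
    x                 ∎

  conclude : x ≈ᴿ 0ᴿ ⊎ x ≈ᴿ fromℚᴿ 1ℚ → z ≈ᶜ ℂᵣ.0# ⊎ z ≈ᶜ ℂᵣ.1#
  conclude (inj₁ x≈0) = inj₁ (x≈0 , y≈0)
  conclude (inj₂ x≈1) = inj₂ (x≈1 , y≈0)

-- Finite sums and geometric sums

module _ {c ℓ : Level} (M : CommutativeMonoid c ℓ) where
  open CommutativeMonoid M
  open CommutativeMonoidSum M using (sum; sum-cong-≋; sum-replicate-zero)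

  sum-0 : ∀ {n} (f : Fin n → Carrier) → (∀ i → f i ≈ ε) → sum f ≈ ε
  sum-0 {n} f f≈0 = trans (sum-cong-≋ f≈0) (sum-replicate-zero n)

  sum-single : ∀ {n} (f : Fin n → Carrier) j → (∀ i → i ≢ j → f i ≈ ε) → sum f ≈ f j
  sum-single f zero    off = trans (∙-congˡ (sum-0 (f ∘ suc) (λ i → off (suc i) λ ()))) (identityʳ (f zero))
  sum-single f (suc j) off = trans
    (∙-cong (off zero λ ()) (sum-single (f ∘ suc) j (λ i i≢j → off (suc i) λ { ≡.refl → i≢j ≡.refl })))
    (identityˡ (f (suc j)))

module Geometric {c ℓ : Level} (R : CommutativeRing c ℓ) where
  open CommutativeRing R
  open SemiringExp semiring using (_^_)
  open SemiringSum semiring using (sum; *-distribˡ-sum; *-distribʳ-sum; sum-cong-≋)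
  open import Algebra.Properties.Ring ring using (+-cancelˡ)
  open SetoidReasoning setoid

  geom : Carrier → ℕ → Carrier
  geom ω n = sum {n} (λ i → ω ^ toℕ i)

  geom-suc : ∀ ω n → geom ω (suc n) ≈ 1# + ω * geom ω n
  geom-suc ω n = +-congˡ (sym (*-distribˡ-sum {n} ω (λ i → ω ^ toℕ i)))

  geom-last : ∀ ω n → geom ω (suc n) ≈ ω ^ n + geom ω n
  geom-last ω zero    = refl
  geom-last ω (suc n) = begin
    geom ω (2 ℕ.+ n)                       ≈⟨ geom-suc ω (suc n) ⟩
    1# + ω * geom ω (suc n)                ≈⟨ +-congˡ (*-congˡ (geom-last ω n)) ⟩
    1# + ω * (ω ^ n + geom ω n)            ≈⟨ +-congˡ (distribˡ ω (ω ^ n) (geom ω n)) ⟩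
    1# + (ω ^ suc n + ω * geom ω n)        ≈⟨ +-assoc 1# _ _ ⟨
    (1# + ω ^ suc n) + ω * geom ω n        ≈⟨ +-congʳ (+-comm 1# (ω ^ suc n)) ⟩
    (ω ^ suc n + 1#) + ω * geom ω n        ≈⟨ +-assoc (ω ^ suc n) 1# _ ⟩
    ω ^ suc n + (1# + ω * geom ω n)        ≈⟨ +-congˡ (geom-suc ω n) ⟨
    ω ^ suc n + geom ω (suc n)             ∎

  -- The sum 1 + ω + ... + ωⁿ can be split at its first or at its last term; for ωⁿ = 1 both terms
  -- are 1 and cancel.
  geom-fixed : ∀ {ω} n → ω ^ n ≈ 1# → ω * geom ω n ≈ geom ω n
  geom-fixed {ω} n ωⁿ≈1 = +-cancelˡ 1# _ _ (begin
    1# + ω * geom ω n      ≈⟨ geom-suc ω n ⟨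
    geom ω (suc n)         ≈⟨ geom-last ω n ⟩
    ω ^ n + geom ω n       ≈⟨ +-congʳ ωⁿ≈1 ⟩
    1# + geom ω n          ∎)

  ^-fixed : ∀ {ω z} n → ω * z ≈ z → ω ^ n * z ≈ z
  ^-fixed {ω} {z} zero    fixed = *-identityˡ z
  ^-fixed {ω} {z} (suc n) fixed = trans (*-assoc ω (ω ^ n) z) (trans (*-congˡ (^-fixed n fixed)) fixed)

  geom-* : ∀ {ω z} n → ω * z ≈ z → geom ω n * z ≈ sum {n} (λ _ → z)
  geom-* {ω} {z} n fixed = trans (*-distribʳ-sum {n} z (λ i → ω ^ toℕ i))
    (sum-cong-≋ {n} (λ i → ^-fixed (toℕ i) fixed))

open Geometric ℂ-commutativeRing

Σᶜ-const : ∀ n z → Σᶜ {n} (λ _ → z) ≈ᶜ ι n *ᶜ z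
Σᶜ-const zero    z = ℂᵣ.sym (ℂᵣ.zeroˡ z)
Σᶜ-const (suc n) z = begin
  z +ᶜ Σᶜ {n} (λ _ → z)         ≈⟨ ℂᵣ.+-cong (ℂᵣ.sym (ℂᵣ.*-identityˡ z)) (Σᶜ-const n z) ⟩
  ℂᵣ.1# *ᶜ z +ᶜ ι n *ᶜ z        ≈⟨ ℂᵣ.distribʳ z ℂᵣ.1# (ι n) ⟨
  (ℂᵣ.1# +ᶜ ι n) *ᶜ z           ≈⟨ ℂᵣ.*-congʳ (ι-suc n) ⟨
  ι (suc n) *ᶜ z                ∎
  where open SetoidReasoning ℂᵣ.setoid

-- Used for three fixed points z of ω: for z = 1 it evaluates the sum at ω = 1, for z the geometric
-- sum g itself it gives g² = n g, and for z a character sum over the field it gives orthogonality.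
geom-scales : ∀ {ω z} n → ω *ᶜ z ≈ᶜ z → geom ω n *ᶜ z ≈ᶜ ι n *ᶜ z
geom-scales {ω} {z} n fixed = ℂᵣ.trans (geom-* n fixed) (Σᶜ-const n z)

geom-1 : ∀ {ω} n → ω ≈ᶜ ℂᵣ.1# → geom ω n ≈ᶜ ι n
geom-1 {ω} n ω≈1 = begin
  geom ω n               ≈⟨ ℂᵣ.*-identityʳ (geom ω n) ⟨
  geom ω n *ᶜ ℂᵣ.1#      ≈⟨ geom-scales n (ℂᵣ.trans (ℂᵣ.*-identityʳ ω) ω≈1) ⟩
  ι n *ᶜ ℂᵣ.1#           ≈⟨ ℂᵣ.*-identityʳ (ι n) ⟩
  ι n                    ∎
  where open SetoidReasoning ℂᵣ.setoid

-- Equality in ℂ is undecidable, but g = 1 + ω + … + ωⁿ⁻¹ satisfies g² = n g,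
-- so that g / n is idempotent, hence 0 or 1.
root-of-unity : ∀ n .{{_ : ℕ.NonZero n}} ω → ω ^ᶜ n ≈ᶜ ℂᵣ.1# → ω ≈ᶜ ℂᵣ.1# ⊎ geom ω n ≈ᶜ ℂᵣ.0#
root-of-unity n ω ωⁿ≈1 = conclude (idempotentᶜ e ee≈e)
  where
  open SetoidReasoning ℂᵣ.setoid
  g = geom ω n
  1/n = fromℚ (+ 1 ℚ./ n)
  e = g *ᶜ 1/n

  ee≈e : e *ᶜ e ≈ᶜ e
  ee≈e = begin
    (g *ᶜ 1/n) *ᶜ (g *ᶜ 1/n)      ≈⟨ ℂᵣ.*-assoc g 1/n e ⟩
    g *ᶜ (1/n *ᶜ (g *ᶜ 1/n))      ≈⟨ ℂᵣ.*-congˡ (ℂᵣ.*-comm 1/n e) ⟩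
    g *ᶜ ((g *ᶜ 1/n) *ᶜ 1/n)      ≈⟨ ℂᵣ.*-congˡ (ℂᵣ.*-assoc g 1/n 1/n) ⟩
    g *ᶜ (g *ᶜ (1/n *ᶜ 1/n))      ≈⟨ ℂᵣ.*-assoc g g _ ⟨
    (g *ᶜ g) *ᶜ (1/n *ᶜ 1/n)      ≈⟨ ℂᵣ.*-congʳ (geom-scales n (geom-fixed n ωⁿ≈1)) ⟩
    (ι n *ᶜ g) *ᶜ (1/n *ᶜ 1/n)    ≈⟨ ℂᵣ.*-congʳ (ℂᵣ.*-comm (ι n) g) ⟩
    (g *ᶜ ι n) *ᶜ (1/n *ᶜ 1/n)    ≈⟨ ℂᵣ.*-assoc g (ι n) _ ⟩
    g *ᶜ (ι n *ᶜ (1/n *ᶜ 1/n))    ≈⟨ ℂᵣ.*-congˡ (ℂᵣ.*-assoc (ι n) 1/n 1/n) ⟨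
    g *ᶜ ((ι n *ᶜ 1/n) *ᶜ 1/n)    ≈⟨ ℂᵣ.*-congˡ (ℂᵣ.trans (ℂᵣ.*-congʳ (ι-inverse n)) (ℂᵣ.*-identityˡ 1/n)) ⟩
    g *ᶜ 1/n                      ∎

  g≈e*n : g ≈ᶜ e *ᶜ ι n
  g≈e*n = begin
    g                       ≈⟨ ℂᵣ.*-identityʳ g ⟨
    g *ᶜ ℂᵣ.1#              ≈⟨ ℂᵣ.*-congˡ (ℂᵣ.trans (ℂᵣ.*-comm 1/n (ι n)) (ι-inverse n)) ⟨
    g *ᶜ (1/n *ᶜ ι n)       ≈⟨ ℂᵣ.*-assoc g 1/n (ι n) ⟨
    e *ᶜ ι n                ∎

  conclude : e ≈ᶜ ℂᵣ.0# ⊎ e ≈ᶜ ℂᵣ.1# → ω ≈ᶜ ℂᵣ.1# ⊎ g ≈ᶜ ℂᵣ.0#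
  conclude (inj₁ e≈0) = inj₂ (ℂᵣ.trans g≈e*n (ℂᵣ.trans (ℂᵣ.*-congʳ e≈0) (ℂᵣ.zeroˡ (ι n))))
  conclude (inj₂ e≈1) = inj₁ (ι-cancel n (begin
    ι n *ᶜ ω           ≈⟨ ℂᵣ.*-comm (ι n) ω ⟩
    ω *ᶜ ι n           ≈⟨ ℂᵣ.*-congˡ g≈n ⟨
    ω *ᶜ g             ≈⟨ geom-fixed n ωⁿ≈1 ⟩
    g                  ≈⟨ g≈n ⟩
    ι n                ≈⟨ ℂᵣ.*-identityʳ (ι n) ⟨
    ι n *ᶜ ℂᵣ.1#       ∎))
    where
    g≈n : g ≈ᶜ ι n
    g≈n = ℂᵣ.trans g≈e*n (ℂᵣ.trans (ℂᵣ.*-congʳ e≈1) (ℂᵣ.*-identityˡ (ι n)))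

ι-sum : ∀ {n} (f : Fin n → ℕ) → ι (Σᴺ f) ≈ᶜ Σᶜ (λ i → ι (f i))
ι-sum {zero}  f = ℂᵣ.refl
ι-sum {suc n} f = ℂᵣ.trans (ι-+ (f zero) (Σᴺ (f ∘ suc))) (ℂᵣ.+-congˡ (ι-sum (f ∘ suc)))

-- Counting in a finite field

Σᴺ-mono : ∀ {n} {f g : Fin n → ℕ} → (∀ i → f i ℕ.≤ g i) → Σᴺ f ℕ.≤ Σᴺ g
Σᴺ-mono {zero}  f≤g = z≤n
Σᴺ-mono {suc n} f≤g = ℕ.+-mono-≤ (f≤g zero) (Σᴺ-mono (f≤g ∘ suc))

-- A strict inequality at one place could not be made up for elsewhere, so equal totals force
-- equality everywhere.
Σᴺ-squeeze : ∀ {n} {f g : Fin n → ℕ} → (∀ i → f i ℕ.≤ g i) → Σᴺ f ≡ Σᴺ g → ∀ i → f i ≡ g i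
Σᴺ-squeeze {suc n} {f} {g} f≤g Σf≡Σg = λ { zero → head ; (suc i) → Σᴺ-squeeze (f≤g ∘ suc) tail i }
  where
  head : f zero ≡ g zero
  head with ℕ.m≤n⇒m<n∨m≡n (f≤g zero)
  ... | inj₂ eq = eq
  ... | inj₁ lt = contradiction Σf≡Σg (ℕ.<⇒≢ (ℕ.+-mono-<-≤ lt (Σᴺ-mono (f≤g ∘ suc))))

  tail : Σᴺ (f ∘ suc) ≡ Σᴺ (g ∘ suc)
  tail = ℕ.+-cancelˡ-≡ (g zero) _ _ (≡.trans (≡.cong (ℕ._+ Σᴺ (f ∘ suc)) (≡.sym head)) Σf≡Σg)

Σᴺ-1 : ∀ n → Σᴺ {n} (λ _ → 1) ≡ n
Σᴺ-1 zero    = ≡.refl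
Σᴺ-1 (suc n) = ≡.cong suc (Σᴺ-1 n)

module _ {a : Level} {P : Set a} where

  -- Counts are written as sums of indicators, so that they can be reindexed and the order of
  -- summation exchanged.
  𝟙 : Dec P → ℕ
  𝟙 d = if does d then 1 else 0

  𝟙-yes : (d : Dec P) → P → 𝟙 d ≡ 1
  𝟙-yes (yes _) _ = ≡.refl
  𝟙-yes (no ¬p) p = contradiction p ¬p

  𝟙-no : (d : Dec P) → ¬ P → 𝟙 d ≡ 0
  𝟙-no (yes p) ¬p = contradiction p ¬p
  𝟙-no (no _)  _  = ≡.refl

𝟙-mono : ∀ {a b} {P : Set a} {Q : Set b} (d : Dec P) (e : Dec Q) → (P → Q) → 𝟙 d ℕ.≤ 𝟙 e
𝟙-mono (no _)  e f = z≤n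
𝟙-mono (yes p) e f = ℕ.≤-reflexive (≡.sym (𝟙-yes e (f p)))

𝟙-or : ∀ {a b c} {P : Set a} {Q : Set b} {R : Set c} (d : Dec P) (e : Dec Q) (f : Dec R) →
       (P → ¬ R → Q) → 𝟙 d ℕ.≤ 𝟙 e ℕ.+ 𝟙 f
𝟙-or (no _)  e f       g = z≤n
𝟙-or (yes _) e (yes _) g = ℕ.m≤n+m 1 (𝟙 e)
𝟙-or (yes p) e (no ¬r) g = ℕ.≤-trans (ℕ.≤-reflexive (≡.sym (𝟙-yes e (g p ¬r)))) (ℕ.m≤m+n (𝟙 e) 0)

𝟙-cong : ∀ {a b} {P : Set a} {Q : Set b} (d : Dec P) (e : Dec Q) → (P → Q) → (Q → P) → 𝟙 d ≡ 𝟙 e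
𝟙-cong d e f g = ℕ.≤-antisym (𝟙-mono d e f) (𝟙-mono e d g)

module _ {a p : Level} {A : Set a} {P : A → Set p} (P? : ∀ x → Dec (P x)) where

  length-filter-++ : ∀ xs ys → length (filter P? (xs ++ ys)) ≡ length (filter P? xs) ℕ.+ length (filter P? ys)
  length-filter-++ xs ys = ≡.trans (≡.cong length (List.filter-++ P? xs ys)) (List.length-++ (filter P? xs))

  length-filter-tabulate : ∀ {n} (f : Fin n → A) → length (filter P? (tabulate f)) ≡ Σᴺ (λ i → 𝟙 (P? (f i)))
  length-filter-tabulate {zero}  f = ≡.refl
  length-filter-tabulate {suc n} f with does (P? (f zero))
  ... | true  = ≡.cong suc (length-filter-tabulate (f ∘ suc))
  ... | false = length-filter-tabulate (f ∘ suc)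

length-filter-product : ∀ {a b p} {A : Set a} {B : Set b} {P : A × B → Set p} (P? : ∀ xy → Dec (P xy))
  {m n} (f : Fin m → A) (g : Fin n → B) →
  length (filter P? (cartesianProduct (tabulate f) (tabulate g))) ≡ Σᴺ (λ i → Σᴺ (λ j → 𝟙 (P? (f i , g j))))
length-filter-product P? {zero}  f g = ≡.refl
length-filter-product P? {suc m} f g = ≡.trans
  (length-filter-++ P? (List.map (f zero ,_) (tabulate g)) _)
  (≡.cong₂ ℕ._+_
    (≡.trans (≡.cong (length ∘ filter P?) (List.map-tabulate g (f zero ,_)))
             (length-filter-tabulate P? (λ j → f zero , g j)))
    (length-filter-product P? (f ∘ suc) g))

-- Extracts a witness constructively: a non-trivial character yields an actual element where its
-- geometric sum vanishes, although its values cannot be tested for equality with 1.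
all-or-any : ∀ {a b n} {P : Fin n → Set a} {Q : Fin n → Set b} → (∀ i → P i ⊎ Q i) → (∀ i → P i) ⊎ ∃ Q
all-or-any {n = zero}  _ = inj₁ λ ()
all-or-any {n = suc n} choice with choice zero | all-or-any (choice ∘ suc)
... | inj₂ q | _            = inj₂ (zero , q)
... | inj₁ _ | inj₂ (i , q) = inj₂ (suc i , q)
... | inj₁ p | inj₁ ps      = inj₁ λ { zero → p ; (suc i) → ps i }

module FiniteFieldProperties {c ℓ : Level} {q : ℕ} (F : FiniteField q c ℓ) where
  open FiniteField F
  open import Algebra.Solver.Ring.NaturalCoefficients.Default commutativeSemiring

  index : Carrier → Fin q
  index = Inverse.to enumeration

  element-index : ∀ x → element (index x) ≈ x
  element-index = Inverse.strictlyInverseʳ enumeration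

  element-injective : ∀ {i j} → element i ≈ element j → i ≡ j
  element-injective {i} {j} eq = ≡.trans (≡.sym (Inverse.strictlyInverseˡ enumeration i))
    (≡.trans (Inverse.to-cong enumeration eq) (Inverse.strictlyInverseˡ enumeration j))

  -- Kept general because it serves four monoids: ℕ for counts, ℂ for character sums, and the field
  -- under addition (for the characteristic) and under multiplication (for Fermat).
  module Sums {a b} (M : CommutativeMonoid a b) where
    private module M = CommutativeMonoid M
    open CommutativeMonoidSum M using (sum; sum-permute; sum-cong-≋)

    sumᶠ : (Carrier → M.Carrier) → M.Carrier
    sumᶠ f = sum (f ∘ element)

    reindex : ∀ (σ τ : Carrier → Carrier) → (∀ {x y} → x ≈ y → σ x ≈ σ y) → (∀ {x y} → x ≈ y → τ x ≈ τ y) →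
              (∀ x → σ (τ x) ≈ x) → (∀ x → τ (σ x) ≈ x) →
              ∀ f → (∀ {x y} → x ≈ y → f x M.≈ f y) → sumᶠ (f ∘ σ) M.≈ sumᶠ f
    reindex σ τ σ-cong τ-cong στ τσ f f-cong = M.sym (M.trans
      (sum-permute (f ∘ element) (permutation (via σ) (via τ)
        (inverse-via σ τ σ-cong στ) (inverse-via τ σ τ-cong τσ)))
      (sum-cong-≋ (λ i → f-cong (element-index (σ (element i))))))
      where
      via : (Carrier → Carrier) → Fin q → Fin q
      via ρ i = index (ρ (element i))
      inverse-via : ∀ ρ ρ′ → (∀ {x y} → x ≈ y → ρ x ≈ ρ y) → (∀ x → ρ (ρ′ x) ≈ x) →
                    ∀ i → via ρ (via ρ′ i) ≡ i
      inverse-via ρ ρ′ ρ-cong ρρ′ i = element-injective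
        (trans (element-index _) (trans (ρ-cong (element-index _)) (ρρ′ (element i))))

    reindex-+ : ∀ a f → (∀ {x y} → x ≈ y → f x M.≈ f y) → sumᶠ (λ x → f (x + a)) M.≈ sumᶠ f
    reindex-+ a = reindex (_+ a) (_- a) +-congʳ +-congʳ (//-rightDividesˡ a) (//-rightDividesʳ a)
      where open import Algebra.Properties.Group +-group using (//-rightDividesˡ; //-rightDividesʳ)

    reindex-* : ∀ {a} → ¬ (a ≈ 0#) → ∀ f → (∀ {x y} → x ≈ y → f x M.≈ f y) → sumᶠ (λ x → f (a * x)) M.≈ sumᶠ f
    reindex-* {a} a≉0 = reindex (a *_) (a ⁻¹ *_) *-congˡ *-congˡ
      (λ x → undo x (⁻¹-inverseʳ a≉0)) (λ x → undo x (trans (*-comm (a ⁻¹) a) (⁻¹-inverseʳ a≉0)))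
      where
      undo : ∀ {a b} x → a * b ≈ 1# → a * (b * x) ≈ x
      undo {a} {b} x ab≈1 = trans (sym (*-assoc a b x)) (trans (*-congʳ ab≈1) (*-identityˡ x))

    sumᶠ-single : ∀ f a → (∀ {x y} → x ≈ y → f x M.≈ f y) → (∀ x → ¬ (x ≈ a) → f x M.≈ M.ε) → sumᶠ f M.≈ f a
    sumᶠ-single f a f-cong off = M.trans
      (sum-single M (f ∘ element) (index a) (λ i i≢a → off (element i)
        (λ eq → i≢a (≡.trans (≡.sym (Inverse.strictlyInverseˡ enumeration i)) (Inverse.to-cong enumeration eq)))))
      (f-cong (element-index a))

  module Σℕ = Sums ℕ.+-0-commutativeMonoid

  count-≈ : ∀ a → Σᴺ (λ i → 𝟙 (element i ≟ a)) ≡ 1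
  count-≈ a = ≡.trans
    (Σℕ.sumᶠ-single (λ x → 𝟙 (x ≟ a)) a (λ {x} {y} x≈y → 𝟙-cong (x ≟ a) (y ≟ a) (trans (sym x≈y)) (trans x≈y))
      (λ x → 𝟙-no (x ≟ a)))
    (𝟙-yes (a ≟ a) refl)

  count-≈′ : ∀ a → Σᴺ (λ i → 𝟙 (a ≟ element i)) ≡ 1
  count-≈′ a = ≡.trans (Σᴺ-cong (λ i → 𝟙-cong (a ≟ element i) (element i ≟ a) sym sym)) (count-≈ a)

  *-cancelʳ : ∀ {x y z} → ¬ (z ≈ 0#) → x * z ≈ y * z → x ≈ y
  *-cancelʳ {x} {y} {z} z≉0 eq = begin
    x                  ≈⟨ undo x ⟨
    (x * z) * z ⁻¹     ≈⟨ *-congʳ eq ⟩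
    (y * z) * z ⁻¹     ≈⟨ undo y ⟩
    y                  ∎
    where
    open SetoidReasoning setoid
    undo : ∀ w → (w * z) * z ⁻¹ ≈ w
    undo w = trans (*-assoc w z _) (trans (*-congˡ (⁻¹-inverseʳ z≉0)) (*-identityʳ w))

  -- The entries of a vector are the coefficients, constant one first, of a
  -- monic polynomial whose leading coefficient is omitted.
  monic : ∀ {n} → Vec Carrier n → Carrier → Carrier
  monic []       x = 1#
  monic (a ∷ as) x = a + x * monic as x

  -- Synthetic division by x - r: the coefficients are the values at r of the tails of the
  -- polynomial, as in Horner's scheme.
  quotient : ∀ {n} → Vec Carrier (suc n) → Carrier → Vec Carrier n
  quotient (a ∷ [])         r = []
  quotient (a ∷ as@(_ ∷ _)) r = monic as r ∷ quotient as r

  -- p(x) - p(r) = (x - r) s(x), with both sides moved so that no subtraction occurs.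
  factor-theorem : ∀ {n} (as : Vec Carrier (suc n)) r x → let s = monic (quotient as r) x in
                   monic as x + r * s ≈ monic as r + x * s
  factor-theorem (a ∷ [])         r x =
    solve 3 (λ a r x → (a :+ x :* con 1) :+ r :* con 1 := (a :+ r :* con 1) :+ x :* con 1) refl a r x
  factor-theorem (a ∷ as@(_ ∷ _)) r x = begin
    (a + x * A) + r * (B + x * s)    ≈⟨ solve 6 (λ a r x A B s →
                                          (a :+ x :* A) :+ r :* (B :+ x :* s) := (a :+ r :* B) :+ x :* (A :+ r :* s)) refl a r x A B s ⟩
    (a + r * B) + x * (A + r * s)    ≈⟨ +-congˡ (*-congˡ (factor-theorem as r x)) ⟩
    (a + r * B) + x * (B + x * s)    ∎
    where
    open SetoidReasoning setoid
    A = monic as x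
    B = monic as r
    s = monic (quotient as r) x

  -- A root r is found by search through the enumeration. By the factor theorem any further root x
  -- satisfies r s(x) = x s(x), so x = r or x is a root of the quotient s, which has smaller degree.
  count-roots : ∀ {n} (as : Vec Carrier n) → Σᴺ (λ i → 𝟙 (monic as (element i) ≟ 0#)) ℕ.≤ n
  count-roots [] = ℕ.≤-reflexive (sum-0 ℕ.+-0-commutativeMonoid {q} _
    (λ i → 𝟙-no (1# ≟ 0#) (λ 1≈0 → 0≉1 (sym 1≈0))))
  count-roots {suc n} as@(_ ∷ _) with Fin.any? (λ i → monic as (element i) ≟ 0#)
  ... | no none = ℕ.≤-trans (ℕ.≤-reflexive (sum-0 ℕ.+-0-commutativeMonoid {q} _
    (λ i → 𝟙-no (monic as (element i) ≟ 0#) (λ root → none (i , root))))) z≤n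
  ... | yes (j , root) = begin
    Σᴺ (λ i → 𝟙 (monic as (element i) ≟ 0#))                         ≤⟨ Σᴺ-mono split ⟩
    Σᴺ (λ i → 𝟙 (element i ≟ r) ℕ.+ 𝟙 (monic bs (element i) ≟ 0#))   ≡⟨ Σᴺ-+ (λ i → 𝟙 (element i ≟ r)) _ ⟩
    Σᴺ (λ i → 𝟙 (element i ≟ r)) ℕ.+ Σᴺ (λ i → 𝟙 (monic bs (element i) ≟ 0#))
                                                                     ≤⟨ ℕ.+-mono-≤ (ℕ.≤-reflexive (count-≈ r)) (count-roots bs) ⟩
    suc n                                                            ∎
    where
    open ℕ.≤-Reasoning
    r = element j
    bs = quotient as r

    split : ∀ i → 𝟙 (monic as (element i) ≟ 0#) ℕ.≤ 𝟙 (element i ≟ r) ℕ.+ 𝟙 (monic bs (element i) ≟ 0#)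
    split i = 𝟙-or (monic as x ≟ 0#) (x ≟ r) (s ≟ 0#) (λ x-root s≉0 → sym (*-cancelʳ s≉0 (begin′
      r * s                   ≈⟨ +-identityˡ _ ⟨
      0# + r * s              ≈⟨ +-congʳ x-root ⟨
      monic as x + r * s      ≈⟨ factor-theorem as r x ⟩
      monic as r + x * s      ≈⟨ +-congʳ root ⟩
      0# + x * s              ≈⟨ +-identityˡ _ ⟩
      x * s                   ∎′)))
      where
      open SetoidReasoning setoid renaming (begin_ to begin′_; _∎ to _∎′)
      x = element i
      s = monic bs x

  monic-0 : ∀ n x → monic (Vec.replicate n 0#) x ≈ x ^ n
  monic-0 zero    x = refl
  monic-0 (suc n) x = trans (+-identityˡ _) (*-congˡ (monic-0 n x))

  count-powers≤ : ∀ n .{{_ : ℕ.NonZero n}} z → Σᴺ (λ i → 𝟙 (element i ^ n ≟ z)) ℕ.≤ n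
  count-powers≤ (suc n) z = ℕ.≤-trans
    (Σᴺ-mono (λ i → 𝟙-mono (element i ^ suc n ≟ z) (monic as (element i) ≟ 0#) (root (element i))))
    (count-roots as)
    where
    -- The polynomial xⁿ⁺¹ - z.
    as = - z ∷ Vec.replicate n 0#
    root : ∀ x → x ^ suc n ≈ z → monic as x ≈ 0#
    root x eq = trans (+-congˡ (trans (*-congˡ (monic-0 n x)) eq)) (-‿inverseˡ z)

  ^-zero : ∀ n .{{_ : ℕ.NonZero n}} {x} → x ≈ 0# → x ^ n ≈ 0#
  ^-zero (suc n) x≈0 = trans (*-congʳ x≈0) (zeroˡ _)

  ^-nonZero : ∀ n {x} → ¬ (x ≈ 0#) → ¬ (x ^ n ≈ 0#)
  ^-nonZero zero    x≉0 1≈0 = 0≉1 (sym 1≈0)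
  ^-nonZero (suc n) x≉0 = *-nonZero x≉0 (^-nonZero n x≉0)

-- Character sums

index-bound : ∀ {n} .{{_ : ℕ.NonZero n}} (k : Fin (n ℕ.∸ 1)) → suc (toℕ k) ℕ.< n
index-bound {n} k = ≡.subst (suc (suc (toℕ k)) ℕ.≤_) (ℕ.suc-pred n) (s≤s (Fin.toℕ<n k))

Σ[1≤i<]-cong : ∀ n .{{_ : ℕ.NonZero n}} {f g : ℕ → ℂ} → (∀ i → 0 ℕ.< i → i ℕ.< n → f i ≈ᶜ g i) →
               Σ[1≤i< n ] f ≈ᶜ Σ[1≤i< n ] g
Σ[1≤i<]-cong n f≈g = Σᶜ-cong {n ℕ.∸ 1} (λ k → f≈g (suc (toℕ k)) ℕ.z<s (index-bound k))

^ᶜ-1 : ∀ n {ω} → ω ≈ᶜ ℂᵣ.1# → ω ^ᶜ n ≈ᶜ ℂᵣ.1#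
^ᶜ-1 zero    ω≈1 = ℂᵣ.refl
^ᶜ-1 (suc n) ω≈1 = ℂᵣ.trans (ℂᵣ.*-cong ω≈1 (^ᶜ-1 n ω≈1)) (ℂᵣ.*-identityˡ ℂᵣ.1#)

module CharacterProperties {c ℓ : Level} {q : ℕ} (F : FiniteField q c ℓ) where
  open FiniteField F
  open FiniteFieldProperties F
  open Characters F
  open SetoidReasoning ℂᵣ.setoid

  module Σℂ = Sums ℂᵣ.+-commutativeMonoid

  χ-zero : ∀ χ {x} → x ≈ 0# → ⟦ χ ⟧ x ≈ᶜ ℂᵣ.0#
  χ-zero χ x≈0 = ℂᵣ.trans (Character.⟦⟧-cong χ x≈0) (Character.⟦0⟧≈0 χ)

  χ-^ : ∀ χ n x → ⟦ χ ⟧ (x ^ n) ≈ᶜ ⟦ χ ⟧ x ^ᶜ n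
  χ-^ χ zero    x = Character.ε-homo χ
  χ-^ χ (suc n) x = ℂᵣ.trans (Character.homo χ x (x ^ n)) (ℂᵣ.*-congˡ (χ-^ χ n x))

  ^ᵡ-value : ∀ χ n {x} → ¬ (x ≈ 0#) → ⟦ χ ^ᵡ n ⟧ x ≈ᶜ ⟦ χ ⟧ x ^ᶜ n
  ^ᵡ-value χ zero    x≉0 = trivialValue-nonZero x≉0
  ^ᵡ-value χ (suc n) x≉0 = ℂᵣ.*-congˡ (^ᵡ-value χ n x≉0)

  order-value : ∀ {n χ} → CharacterOfOrder n χ → ∀ {x} → ¬ (x ≈ 0#) → ⟦ χ ⟧ x ^ᶜ n ≈ᶜ ℂᵣ.1#
  order-value {n} {χ} (_ , χⁿ≈1 , _) {x} x≉0 =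
    ℂᵣ.trans (ℂᵣ.sym (^ᵡ-value χ n x≉0)) (ℂᵣ.trans (χⁿ≈1 x) (trivialValue-nonZero x≉0))

  module _ (χ : Character) (n : ℕ) .{{_ : ℕ.NonZero n}}
           (χⁿ≈1 : ∀ x → ¬ (x ≈ 0#) → ⟦ χ ⟧ x ^ᶜ n ≈ᶜ ℂᵣ.1#) where

    private
      total = Σᶜ (λ i → ⟦ χ ⟧ (element i))

      -- Multiplication by a permutes the field.
      moved : ∀ a → ¬ (a ≈ 0#) → ⟦ χ ⟧ a *ᶜ total ≈ᶜ total
      moved a a≉0 = begin
        ⟦ χ ⟧ a *ᶜ total                              ≈⟨ *-distribˡ-Σᶜ {q} (⟦ χ ⟧ a) (λ i → ⟦ χ ⟧ (element i)) ⟩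
        Σᶜ (λ i → ⟦ χ ⟧ a *ᶜ ⟦ χ ⟧ (element i))       ≈⟨ Σᶜ-cong {q} (λ i → Character.homo χ a (element i)) ⟨
        Σᶜ (λ i → ⟦ χ ⟧ (a * element i))              ≈⟨ Σℂ.reindex-* a≉0 ⟦ χ ⟧ (Character.⟦⟧-cong χ) ⟩
        total                                         ∎

      choice : ∀ i → (⟦ χ ⟧ (element i) ≈ᶜ trivialValue (element i)) ⊎
                     (¬ (element i ≈ 0#) × geom (⟦ χ ⟧ (element i)) n ≈ᶜ ℂᵣ.0#)
      choice i = by (element i ≟ 0#)
        where
        by : Dec (element i ≈ 0#) → _
        by (yes x≈0) = inj₁ (ℂᵣ.trans (χ-zero χ x≈0) (ℂᵣ.sym (trivialValue-zero x≈0)))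
        by (no x≉0)  = Sum.map
          (λ χx≈1 → ℂᵣ.trans χx≈1 (ℂᵣ.sym (trivialValue-nonZero x≉0))) (x≉0 ,_)
          (root-of-unity n (⟦ χ ⟧ (element i)) (χⁿ≈1 (element i) x≉0))

    -- The usual division by χ(a) - 1 is replaced: the total is fixed by χ(a), so multiplying it by
    -- the geometric sum of χ(a) gives n times the total, and that geometric sum is 0.
    orthogonality : ¬ (χ ≈ᵡ trivial) → Σᶜ (λ i → ⟦ χ ⟧ (element i)) ≈ᶜ ℂᵣ.0#
    orthogonality χ≉1 = [ (λ all → contradiction (everywhere all) χ≉1) , vanish ]′ (all-or-any choice)
      where
      everywhere : (∀ i → ⟦ χ ⟧ (element i) ≈ᶜ trivialValue (element i)) → χ ≈ᵡ trivial
      everywhere all x = ℂᵣ.trans (Character.⟦⟧-cong χ (sym (element-index x)))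
        (ℂᵣ.trans (all (index x)) (Character.⟦⟧-cong trivial (element-index x)))

      vanish : (∃ λ i → ¬ (element i ≈ 0#) × geom (⟦ χ ⟧ (element i)) n ≈ᶜ ℂᵣ.0#) → total ≈ᶜ ℂᵣ.0#
      vanish (i , a≉0 , g≈0) = ι-cancel n (begin
        ι n *ᶜ total                          ≈⟨ geom-scales n (moved (element i) a≉0) ⟨
        geom (⟦ χ ⟧ (element i)) n *ᶜ total   ≈⟨ ℂᵣ.*-congʳ g≈0 ⟩
        ℂᵣ.0# *ᶜ total                        ≈⟨ ℂᵣ.zeroˡ total ⟩
        ℂᵣ.0#                                 ≈⟨ ℂᵣ.zeroʳ (ι n) ⟨
        ι n *ᶜ ℂᵣ.0#                          ∎)

  module _ {n : ℕ} {χ : Character} (χ-order : CharacterOfOrder n χ) where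

    -- Minimality of the order makes χⁱ non-trivial, and its non-zero values are again n-th roots of
    -- unity.
    power-sum≈0 : ∀ i → 0 ℕ.< i → i ℕ.< n → Σᶜ (λ j → ⟦ χ ^ᵡ i ⟧ (element j)) ≈ᶜ ℂᵣ.0#
    power-sum≈0 i 0<i i<n = orthogonality (χ ^ᵡ i) n {{ℕ.>-nonZero (proj₁ χ-order)}} finite (proj₂ (proj₂ χ-order) i 0<i i<n)
      where
      finite : ∀ x → ¬ (x ≈ 0#) → ⟦ χ ^ᵡ i ⟧ x ^ᶜ n ≈ᶜ ℂᵣ.1#
      finite x x≉0 = begin
        ⟦ χ ^ᵡ i ⟧ x ^ᶜ n        ≈⟨ ^ᶜ-congˡ n (^ᵡ-value χ i x≉0) ⟩
        (⟦ χ ⟧ x ^ᶜ i) ^ᶜ n      ≈⟨ ^ᶜ-assocʳ (⟦ χ ⟧ x) i n ⟩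
        ⟦ χ ⟧ x ^ᶜ (i ℕ.* n)     ≡⟨ ≡.cong (⟦ χ ⟧ x ^ᶜ_) (ℕ.*-comm i n) ⟩
        ⟦ χ ⟧ x ^ᶜ (n ℕ.* i)     ≈⟨ ^ᶜ-assocʳ (⟦ χ ⟧ x) n i ⟨
        (⟦ χ ⟧ x ^ᶜ n) ^ᶜ i      ≈⟨ ^ᶜ-1 i (order-value χ-order x≉0) ⟩
        ℂᵣ.1#                    ∎

  -- The term of index 0 is the constant 1 and not the trivial character, so that z = 0, with its
  -- single root, is counted correctly too.
  power-sum : ℕ → Character → Carrier → ℂ
  power-sum n χ z = ℂᵣ.1# +ᶜ Σ[1≤i< n ] (λ i → ⟦ χ ^ᵡ i ⟧ z)

  power-sum-zero : ∀ n χ {z} → z ≈ 0# → power-sum n χ z ≈ᶜ ℂᵣ.1#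
  power-sum-zero n χ {z} z≈0 = ℂᵣ.trans (ℂᵣ.+-congˡ
    (sum-0 ℂᵣ.+-commutativeMonoid {n ℕ.∸ 1} (λ i → ⟦ χ ^ᵡ suc (toℕ i) ⟧ z) (λ i → χ-zero (χ ^ᵡ suc (toℕ i)) z≈0)))
    (ℂᵣ.+-identityʳ ℂᵣ.1#)

  power-sum-nonZero : ∀ n .{{_ : ℕ.NonZero n}} χ {z} → ¬ (z ≈ 0#) → power-sum n χ z ≈ᶜ geom (⟦ χ ⟧ z) n
  power-sum-nonZero (suc n) χ z≉0 = ℂᵣ.+-congˡ (Σᶜ-cong {n} (λ i → ^ᵡ-value χ (suc (toℕ i)) z≉0))

  count-powers : ℕ → Carrier → ℕ
  count-powers n z = Σᴺ (λ i → 𝟙 (element i ^ n ≟ z))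

  count-powers-total : ∀ n → Σᴺ (λ i → count-powers n (element i)) ≡ q
  count-powers-total n = ≡.trans (Σᴺ-comm {q} {q} (λ i j → 𝟙 (element j ^ n ≟ element i)))
    (≡.trans (Σᴺ-cong {q} (λ j → count-≈′ (element j ^ n))) (Σᴺ-1 q))

  module CountPowers {n : ℕ} {χ : Character} (χ-order : CharacterOfOrder n χ) where
    private instance
      n-nonZero : ℕ.NonZero n
      n-nonZero = ℕ.>-nonZero (proj₁ χ-order)

    -- The bound is a natural number r because the values in ℂ are not ordered here. It is 1 for z =
    -- 0, n for χ(z) = 1, and 0 if the geometric sum vanishes.
    bounded-by : ∀ z → ∃ λ r → ι r ≈ᶜ power-sum n χ z × count-powers n z ℕ.≤ r
    bounded-by z = by (z ≟ 0#)
      where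
      zero-root : ∀ {x} → x ^ n ≈ 0# → x ≈ 0#
      zero-root {x} xⁿ≈0 = decidable-stable (x ≟ 0#) (λ x≉0 → ^-nonZero n x≉0 xⁿ≈0)

      -- A non-zero n-th power has χ(z) = χ(y)ⁿ = 1, which makes the geometric sum n instead of 0.
      not-power : ¬ (z ≈ 0#) → geom (⟦ χ ⟧ z) n ≈ᶜ ℂᵣ.0# → ∀ y → ¬ (y ^ n ≈ z)
      not-power z≉0 g≈0 y yⁿ≈z = ℕ.≢-nonZero⁻¹ n (ι-injective n 0 (ℂᵣ.trans (ℂᵣ.sym (geom-1 n χz≈1)) g≈0))
        where
        y≉0 : ¬ (y ≈ 0#)
        y≉0 y≈0 = z≉0 (trans (sym yⁿ≈z) (^-zero n y≈0))
        χz≈1 : ⟦ χ ⟧ z ≈ᶜ ℂᵣ.1#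
        χz≈1 = ℂᵣ.trans (Character.⟦⟧-cong χ (sym yⁿ≈z)) (ℂᵣ.trans (χ-^ χ n y) (order-value χ-order y≉0))

      by : Dec (z ≈ 0#) → ∃ λ r → ι r ≈ᶜ power-sum n χ z × count-powers n z ℕ.≤ r
      by (yes z≈0) = 1 , ℂᵣ.sym (power-sum-zero n χ z≈0) , ℕ.≤-trans
        (Σᴺ-mono (λ i → 𝟙-mono (element i ^ n ≟ z) (element i ≟ 0#) (λ eq → zero-root (trans eq z≈0))))
        (ℕ.≤-reflexive (count-≈ 0#))
      by (no z≉0)  =
        [ (λ χz≈1 → n , ℂᵣ.sym (ℂᵣ.trans (power-sum-nonZero n χ z≉0) (geom-1 n χz≈1)) , count-powers≤ n z)
        , (λ g≈0 → 0 , ℂᵣ.sym (ℂᵣ.trans (power-sum-nonZero n χ z≉0) g≈0) , ℕ.≤-reflexive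
            (sum-0 ℕ.+-0-commutativeMonoid {q} _ (λ i → 𝟙-no (element i ^ n ≟ z) (not-power z≉0 g≈0 (element i)))))
        ]′ (root-of-unity n (⟦ χ ⟧ z) (order-value χ-order z≉0))

    private
      r : Carrier → ℕ
      r z = proj₁ (bounded-by z)

      r-value : ∀ z → ι (r z) ≈ᶜ power-sum n χ z
      r-value z = proj₁ (proj₂ (bounded-by z))

    power-sums-total : Σᶜ (λ i → power-sum n χ (element i)) ≈ᶜ ι q
    power-sums-total = begin
      Σᶜ (λ i → power-sum n χ (element i))
        ≈⟨ Σᶜ-+ {q} (λ _ → ℂᵣ.1#) (λ i → Σ[1≤i< n ] (λ k → ⟦ χ ^ᵡ k ⟧ (element i))) ⟩
      Σᶜ {q} (λ _ → ℂᵣ.1#) +ᶜ Σᶜ (λ i → Σ[1≤i< n ] (λ k → ⟦ χ ^ᵡ k ⟧ (element i)))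
        ≈⟨ ℂᵣ.+-cong (ℂᵣ.trans (Σᶜ-const q ℂᵣ.1#) (ℂᵣ.*-identityʳ (ι q)))
             (Σᶜ-comm {q} {n ℕ.∸ 1} (λ i k → ⟦ χ ^ᵡ suc (toℕ k) ⟧ (element i))) ⟩
      ι q +ᶜ Σᶜ {n ℕ.∸ 1} (λ k → Σᶜ (λ i → ⟦ χ ^ᵡ suc (toℕ k) ⟧ (element i)))
        ≈⟨ ℂᵣ.+-congˡ (sum-0 ℂᵣ.+-commutativeMonoid {n ℕ.∸ 1} _ (λ k → power-sum≈0 χ-order (suc (toℕ k)) ℕ.z<s (index-bound k))) ⟩
      ι q +ᶜ ℂᵣ.0#     ≈⟨ ℂᵣ.+-identityʳ (ι q) ⟩
      ι q              ∎

    r-total : Σᴺ (λ i → r (element i)) ≡ q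
    r-total = ι-injective (Σᴺ (λ i → r (element i))) q (begin
      ι (Σᴺ (λ i → r (element i)))            ≈⟨ ι-sum {q} (λ i → r (element i)) ⟩
      Σᶜ (λ i → ι (r (element i)))            ≈⟨ Σᶜ-cong {q} (λ i → r-value (element i)) ⟩
      Σᶜ (λ i → power-sum n χ (element i))    ≈⟨ power-sums-total ⟩
      ι q                                     ∎)

    -- The count is at most the power sum at every element, and both total q.
    count-powers≈ : ∀ i → ι (count-powers n (element i)) ≈ᶜ power-sum n χ (element i)
    count-powers≈ i = ℂᵣ.trans (ι-cong (Σᴺ-squeeze (λ j → proj₂ (proj₂ (bounded-by (element j))))
      (≡.trans (count-powers-total n) (≡.sym r-total)) i)) (r-value (element i))
      where
      ι-cong : ∀ {m k} → m ≡ k → ι m ≈ᶜ ι k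
      ι-cong ≡.refl = ℂᵣ.refl

-- The cubic (x - 1)(x² + 1/3)

exponent : ∀ k → (1 ℕ.+ 2 ℕ.* k) ℕ.* 3 ≡ (2 ℕ.+ 3 ℕ.* k) ℕ.+ (1 ℕ.+ 3 ℕ.* k)
exponent = solve 1 (λ k → (con 1 :+ con 2 :* k) :* con 3 := (con 2 :+ con 3 :* k) :+ (con 1 :+ con 3 :* k)) ≡.refl
  where open ℕ.+-*-Solver

module FieldArithmetic {c ℓ : Level} {q : ℕ} (F : FiniteField q c ℓ) where
  open FiniteField F hiding (zero)
  open FiniteFieldProperties F
  open SemiringExp semiring using (^-congˡ; ^-homo-*; ^-assocʳ)
  open MonoidMult +-monoid using (×-congˡ)
  open SemiringMult semiring using (×1-homo-*)
  open import Algebra.Properties.Ring ring using (+-cancelˡ)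
  open import Algebra.Solver.Ring.NaturalCoefficients.Default commutativeSemiring
  open SetoidReasoning setoid

  private
    module Σ = Sums +-commutativeMonoid
    module Π = Sums *-commutativeMonoid
    open CommutativeMonoidSum +-commutativeMonoid using (sum; ∑-distrib-+; sum-replicate)
    open CommutativeMonoidSum *-commutativeMonoid using () renaming
      (sum to product; ∑-distrib-+ to product-*; sum-replicate to product-replicate; sum-cong-≋ to product-cong)

  -- Adding 1 permutes the field, so the sum of all elements is unchanged when 1 is added to each of
  -- its q terms.
  q×1≈0 : q times 1# ≈ 0#
  q×1≈0 = +-cancelˡ (sum element) (q times 1#) 0# (begin
    sum element + q times 1#             ≈⟨ +-congˡ (sum-replicate q) ⟨
    sum element + sum {q} (λ _ → 1#)     ≈⟨ ∑-distrib-+ {q} element (λ _ → 1#) ⟨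
    sum (λ i → element i + 1#)           ≈⟨ Σ.reindex-+ 1# (λ x → x) (λ eq → eq) ⟩
    sum element                          ≈⟨ +-identityʳ _ ⟨
    sum element + 0#                     ∎)

  ×1-multiple : ∀ m {n} → n times 1# ≈ 0# → (m ℕ.* n) times 1# ≈ 0#
  ×1-multiple m {n} n≈0 = trans (×1-homo-* m n) (trans (*-congˡ n≈0) (zeroʳ _))

  ×1-^ : ∀ p e → (p ℕ.^ e) times 1# ≈ (p times 1#) ^ e
  ×1-^ p zero    = +-identityʳ 1#
  ×1-^ p (suc e) = trans (×1-homo-* p (p ℕ.^ e)) (*-congˡ (×1-^ p e))

  -- A Bézout identity in ℕ exhibits two consecutive numbers which are multiples of m and n; if both
  -- vanish in the field, then so does 1.
  coprime⇒¬both-zero : ∀ {m n} → Coprime m n → m times 1# ≈ 0# → ¬ (n times 1# ≈ 0#)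
  coprime⇒¬both-zero {m} {n} coprime m≈0 n≈0 = aux (Coprime.coprime-Bézout coprime)
    where
    impossible : ∀ j k → 1 ℕ.+ j ≡ k → j times 1# ≈ 0# → ¬ (k times 1# ≈ 0#)
    impossible j k ≡.refl j≈0 1+j≈0 = 0≉1 (sym (trans (sym (+-identityʳ 1#)) (trans (+-congˡ (sym j≈0)) 1+j≈0)))

    aux : ¬ Bézout.Identity 1 m n
    aux (Bézout.+- x y eq) = impossible (y ℕ.* n) (x ℕ.* m) eq (×1-multiple y n≈0) (×1-multiple x m≈0)
    aux (Bézout.-+ x y eq) = impossible (x ℕ.* m) (y ℕ.* n) eq (×1-multiple x m≈0) (×1-multiple y n≈0)

  -- The e-th power of p · 1 is q · 1 = 0, and a field has no non-zero nilpotents.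
  characteristic : ∀ {p} e → q ≡ p ℕ.^ e → p times 1# ≈ 0#
  characteristic {p} e q≡pᵉ = decidable-stable (p times 1# ≟ 0#) (λ p≉0 → ^-nonZero e p≉0
    (trans (sym (×1-^ p e)) (trans (×-congˡ {1#} (≡.sym q≡pᵉ)) q×1≈0)))

  coprime⇒nonZero : ∀ {p} e → q ≡ p ℕ.^ e → ∀ {n} → Coprime p n → ¬ (n times 1# ≈ 0#)
  coprime⇒nonZero e q≡pᵉ coprime = coprime⇒¬both-zero coprime (characteristic e q≡pᵉ)

  -- Multiplication by u permutes the non-zero elements, whose product
  -- therefore absorbs u^(q-1); zero is given the factor 1.
  fermat : ∀ u → u ^ q ≈ u
  fermat u = by (u ≟ 0#)
    where
    on : ∀ {x} → Dec (x ≈ 0#) → Carrier → Carrier → Carrier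
    on (yes _) a b = a
    on (no _)  a b = b

    on-zero : ∀ {x} (d : Dec (x ≈ 0#)) {a b} → x ≈ 0# → on d a b ≈ a
    on-zero (yes _)  _   = refl
    on-zero (no x≉0) x≈0 = contradiction x≈0 x≉0

    on-nonZero : ∀ {x} (d : Dec (x ≈ 0#)) {a b} → ¬ (x ≈ 0#) → on d a b ≈ b
    on-nonZero (yes x≈0) x≉0 = contradiction x≈0 x≉0
    on-nonZero (no _)    _   = refl

    unit : Carrier → Carrier
    unit x = on (x ≟ 0#) 1# x

    unit-cong : ∀ {x y} → x ≈ y → unit x ≈ unit y
    unit-cong {x} {y} x≈y = aux (x ≟ 0#)
      where
      aux : Dec (x ≈ 0#) → unit x ≈ unit y
      aux (yes x≈0) = trans (on-zero (x ≟ 0#) x≈0) (sym (on-zero (y ≟ 0#) (trans (sym x≈y) x≈0)))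
      aux (no x≉0)  = trans (on-nonZero (x ≟ 0#) x≉0)
        (trans x≈y (sym (on-nonZero (y ≟ 0#) (λ y≈0 → x≉0 (trans x≈y y≈0)))))

    unit-nonZero : ∀ x → ¬ (unit x ≈ 0#)
    unit-nonZero x = aux (x ≟ 0#)
      where
      aux : Dec (x ≈ 0#) → ¬ (unit x ≈ 0#)
      aux (yes x≈0) eq = 0≉1 (trans (sym eq) (on-zero (x ≟ 0#) x≈0))
      aux (no x≉0)  eq = x≉0 (trans (sym (on-nonZero (x ≟ 0#) x≉0)) eq)

    product-nonZero : ∀ {n} (f : Fin n → Carrier) → (∀ i → ¬ (f i ≈ 0#)) → ¬ (product f ≈ 0#)
    product-nonZero {zero}  f f≉0 = 0≉1 ∘ sym
    product-nonZero {suc n} f f≉0 = *-nonZero (f≉0 zero) (product-nonZero (f ∘ suc) (f≉0 ∘ suc))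

    by : Dec (u ≈ 0#) → u ^ q ≈ u
    by (yes u≈0) = trans (^-zero q {{order-nonZero}} u≈0) (sym u≈0)
    by (no u≉0)  = begin
      u ^ q                                  ≈⟨ product-replicate q ⟨
      product {q} (λ _ → u)                  ≈⟨ product-cong {q} (λ i → split (element i)) ⟩
      product (λ i → κ (element i) * κ′ (element i))
                                             ≈⟨ product-* {q} (κ ∘ element) (κ′ ∘ element) ⟩
      product (κ ∘ element) * product (κ′ ∘ element)
                                             ≈⟨ *-cong κ-product κ′-product ⟩
      1# * u                                 ≈⟨ *-identityˡ u ⟩
      u                                      ∎
      where
      -- The q factors u are shared out: `κ` keeps those at non-zero elements, `κ′` the one at zero.
      -- The first product is u^(q-1) = 1, and the second supplies the remaining u.
      κ κ′ : Carrier → Carrier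
      κ x  = on (x ≟ 0#) 1# u
      κ′ x = on (x ≟ 0#) u 1#

      split : ∀ x → u ≈ κ x * κ′ x
      split x with x ≟ 0#
      ... | yes _ = sym (*-identityˡ u)
      ... | no _  = sym (*-identityʳ u)

      κ-unit : ∀ x → unit (u * x) ≈ κ x * unit x
      κ-unit x = aux (x ≟ 0#)
        where
        aux : Dec (x ≈ 0#) → unit (u * x) ≈ κ x * unit x
        aux (yes x≈0) = trans (on-zero (u * x ≟ 0#) (trans (*-congˡ x≈0) (zeroʳ u)))
          (sym (trans (*-cong (on-zero (x ≟ 0#) x≈0) (on-zero (x ≟ 0#) x≈0)) (*-identityˡ 1#)))
        aux (no x≉0)  = trans (on-nonZero (u * x ≟ 0#) (*-nonZero u≉0 x≉0))
          (sym (*-cong (on-nonZero (x ≟ 0#) x≉0) (on-nonZero (x ≟ 0#) x≉0)))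

      κ-product : product (κ ∘ element) ≈ 1#
      κ-product = *-cancelʳ (product-nonZero (unit ∘ element) (λ i → unit-nonZero (element i))) (begin
        product (κ ∘ element) * product (unit ∘ element)     ≈⟨ product-* {q} (κ ∘ element) (unit ∘ element) ⟨
        product (λ i → κ (element i) * unit (element i))     ≈⟨ product-cong {q} (λ i → κ-unit (element i)) ⟨
        product (λ i → unit (u * element i))                 ≈⟨ Π.reindex-* u≉0 unit unit-cong ⟩
        product (unit ∘ element)                             ≈⟨ *-identityˡ _ ⟨
        1# * product (unit ∘ element)                        ∎)

      κ′-cong : ∀ {x y} → x ≈ y → κ′ x ≈ κ′ y
      κ′-cong {x} {y} x≈y = aux (x ≟ 0#)
        where
        aux : Dec (x ≈ 0#) → κ′ x ≈ κ′ y
        aux (yes x≈0) = trans (on-zero (x ≟ 0#) x≈0) (sym (on-zero (y ≟ 0#) (trans (sym x≈y) x≈0)))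
        aux (no x≉0)  = trans (on-nonZero (x ≟ 0#) x≉0)
          (sym (on-nonZero (y ≟ 0#) (λ y≈0 → x≉0 (trans x≈y y≈0))))

      κ′-product : product (κ′ ∘ element) ≈ u
      κ′-product = trans (Π.sumᶠ-single κ′ 0# κ′-cong (λ x x≉0 → on-nonZero (x ≟ 0#) x≉0))
        (on-zero (0# ≟ 0#) refl)

  module CubeRoot (k : ℕ) (q≡2+3k : q ≡ 2 ℕ.+ 3 ℕ.* k) where

    -- The exponent inverts 3 modulo q - 1, as 3(1 + 2k) = 1 + 2(q - 1).
    cube-root : Carrier → Carrier
    cube-root w = w ^ (1 ℕ.+ 2 ℕ.* k)

    -- The exponent is q + (q - 1), so Fermat in the form w^q = w applies twice, with no separate
    -- case for w = 0.
    ^-[1+2k]*3 : ∀ w → w ^ ((1 ℕ.+ 2 ℕ.* k) ℕ.* 3) ≈ w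
    ^-[1+2k]*3 w = begin
      w ^ ((1 ℕ.+ 2 ℕ.* k) ℕ.* 3)         ≡⟨ ≡.cong (w ^_) (exponent k) ⟩
      w ^ ((2 ℕ.+ 3 ℕ.* k) ℕ.+ (1 ℕ.+ 3 ℕ.* k))  ≡⟨ ≡.cong (λ n → w ^ (n ℕ.+ (1 ℕ.+ 3 ℕ.* k))) q≡2+3k ⟨
      w ^ (q ℕ.+ (1 ℕ.+ 3 ℕ.* k))         ≈⟨ ^-homo-* w q (1 ℕ.+ 3 ℕ.* k) ⟩
      w ^ q * w ^ (1 ℕ.+ 3 ℕ.* k)         ≈⟨ *-congʳ (fermat w) ⟩
      w ^ (2 ℕ.+ 3 ℕ.* k)                 ≡⟨ ≡.cong (w ^_) q≡2+3k ⟨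
      w ^ q                               ≈⟨ fermat w ⟩
      w                                   ∎

    cube-root-cube : ∀ w → cube-root w ^ 3 ≈ w
    cube-root-cube w = trans (^-assocʳ w (1 ℕ.+ 2 ℕ.* k) 3) (^-[1+2k]*3 w)

    cube-cube-root : ∀ w → cube-root (w ^ 3) ≈ w
    cube-cube-root w = trans (^-assocʳ w 3 (1 ℕ.+ 2 ℕ.* k))
      (trans (reflexive (≡.cong (w ^_) (ℕ.*-comm 3 (1 ℕ.+ 2 ℕ.* k)))) (^-[1+2k]*3 w))

  module Cubic (2≉0 : ¬ (2 times 1# ≈ 0#)) (3≉0 : ¬ (3 times 1# ≈ 0#)) where

    t s a : Carrier
    t = reduce (+ 1 / 3)
    s = t + t
    a = s ^ 3

    3t≈1 : t + (t + t) ≈ 1#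
    3t≈1 = begin
      t + (t + t)               ≈⟨ solve 1 (λ t → t :+ (t :+ t) := (con 1 :+ (con 1 :+ (con 1 :+ con 0))) :* t) refl t ⟩
      (3 times 1#) * t          ≈⟨ *-congˡ (trans (*-congʳ (+-identityʳ 1#)) (*-identityˡ _)) ⟩
      (3 times 1#) * (3 times 1#) ⁻¹   ≈⟨ ⁻¹-inverseʳ 3≉0 ⟩
      1#                        ∎

    -- Because 3s = 2.
    s≉0 : ¬ (s ≈ 0#)
    s≉0 s≈0 = 2≉0 (begin
      2 times 1#                        ≈⟨ +-congˡ (+-identityʳ 1#) ⟩
      1# + 1#                           ≈⟨ +-cong 3t≈1 3t≈1 ⟨
      (t + (t + t)) + (t + (t + t))     ≈⟨ solve 1 (λ t → (t :+ (t :+ t)) :+ (t :+ (t :+ t)) := (t :+ t) :+ ((t :+ t) :+ (t :+ t))) refl t ⟩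
      s + (s + s)                       ≈⟨ +-cong s≈0 (+-cong s≈0 s≈0) ⟩
      0# + (0# + 0#)                    ≈⟨ solve 0 (con 0 :+ (con 0 :+ con 0) := con 0) refl ⟩
      0#                                ∎)

    a≉0 : ¬ (a ≈ 0#)
    a≉0 = ^-nonZero 3 s≉0

    cubic : Carrier → Carrier
    cubic x = (x - 1#) * (x ^ 2 + t)

    cubic-cong : ∀ {x y} → x ≈ y → cubic x ≈ cubic y
    cubic-cong x≈y = *-cong (+-congʳ x≈y) (+-congʳ (^-congˡ 2 x≈y))

    -- x³ - x² + x/3 - 1/3 = (x - 1/3)³ - 8/27
    cubic-depressed : ∀ v → cubic (s * v + t) ≈ a * (v ^ 3 - 1#)
    cubic-depressed v = begin
      (s * v + t + m) * ((s * v + t) ^ 2 + t)             ≈⟨ *-cong linear quadratic ⟩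
      (s * (v + m)) * (s ^ 2 * (v ^ 2 + (v + 1#)))        ≈⟨ solve 3 (λ s v m → (s :* (v :+ m)) :* (s :^ 2 :* (v :^ 2 :+ (v :+ con 1))) :=
                                                              s :^ 3 :* ((v :^ 3 :+ m) :+ (con 1 :+ m) :* (v :^ 2 :+ v))) refl s v m ⟩
      a * ((v ^ 3 + m) + (1# + m) * (v ^ 2 + v))          ≈⟨ *-congˡ (+-congˡ (trans (*-congʳ (-‿inverseʳ 1#)) (zeroˡ _))) ⟩
      a * ((v ^ 3 + m) + 0#)                              ≈⟨ *-congˡ (+-identityʳ _) ⟩
      a * (v ^ 3 + m)                                     ∎
      where
      -- The solver handles semiring identities only, so -1 is an opaque `m`, and 1 + m = 0 is
      -- applied by hand to multiples of 1 + m inserted or split off.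
      m = - 1#

      linear : s * v + t + m ≈ s * (v + m)
      linear = begin
        s * v + t + m                         ≈⟨ +-identityʳ _ ⟨
        (s * v + t + m) + 0#                  ≈⟨ +-congˡ (trans (*-congˡ (-‿inverseʳ 1#)) (zeroʳ s)) ⟨
        (s * v + t + m) + s * (1# + m)        ≈⟨ solve 3 (λ t v m → let s = t :+ t in (s :* v :+ t :+ m) :+ s :* (con 1 :+ m) :=
                                                   s :* (v :+ m) :+ ((t :+ s) :+ m)) refl t v m ⟩
        s * (v + m) + ((t + s) + m)           ≈⟨ +-congˡ (trans (+-congʳ 3t≈1) (-‿inverseʳ 1#)) ⟩
        s * (v + m) + 0#                      ≈⟨ +-identityʳ _ ⟩
        s * (v + m)                           ∎

      quadratic : (s * v + t) ^ 2 + t ≈ s ^ 2 * (v ^ 2 + (v + 1#))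
      quadratic = begin
        -- Writing the last t as t · 3t makes both sides homogeneous of degree 2 in t, and a pure
        -- semiring identity remains.
        (s * v + t) ^ 2 + t                   ≈⟨ +-congˡ (trans (*-congˡ 3t≈1) (*-identityʳ t)) ⟨
        (s * v + t) ^ 2 + t * (t + (t + t))   ≈⟨ solve 2 (λ t v → let s = t :+ t in (s :* v :+ t) :^ 2 :+ t :* (t :+ (t :+ t)) :=
                                                   s :^ 2 :* (v :^ 2 :+ (v :+ con 1))) refl t v ⟩
        s ^ 2 * (v ^ 2 + (v + 1#))            ∎

    -- a = 8/27
    a⁻¹≈27/8 : a ⁻¹ ≈ reduce (+ 27 / 8)
    a⁻¹≈27/8 = sym (⁻¹-unique (begin
      a * (27 times 1# * (8 times 1#) ⁻¹)       ≈⟨ *-assoc a (27 times 1#) _ ⟨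
      (a * 27 times 1#) * (8 times 1#) ⁻¹       ≈⟨ *-congʳ a·27≈8 ⟩
      8 times 1# * (8 times 1#) ⁻¹              ≈⟨ ⁻¹-inverseʳ 8≉0 ⟩
      1#                                        ∎))
      where
      8≉0 : ¬ (8 times 1# ≈ 0#)
      8≉0 8≈0 = ^-nonZero 3 2≉0 (trans (sym (×1-^ 2 3)) 8≈0)

      a·27≈8 : a * 27 times 1# ≈ 8 times 1#
      a·27≈8 = begin
        a * 27 times 1#                      ≈⟨ *-congˡ (×1-^ 3 3) ⟩
        s ^ 3 * (3 times 1#) ^ 3             ≈⟨ solve 2 (λ t u → (t :+ t) :^ 3 :* u :^ 3 := ((u :* t) :+ (u :* t)) :^ 3) refl t (3 times 1#) ⟩
        ((3 times 1#) * t + (3 times 1#) * t) ^ 3  ≈⟨ ^-congˡ 3 (+-cong 3·t≈1 (trans 3·t≈1 (sym (+-identityʳ 1#)))) ⟩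
        (2 times 1#) ^ 3                     ≈⟨ ×1-^ 2 3 ⟨
        8 times 1#                           ∎
        where
        3·t≈1 : (3 times 1#) * t ≈ 1#
        3·t≈1 = trans (solve 1 (λ t → (con 1 :+ (con 1 :+ (con 1 :+ con 0))) :* t := t :+ (t :+ t)) refl t) 3t≈1

-- Integer divisibility is divisibility of absolute values, so q = 0 and q = 1 would mean that 3
-- divides 2 or 1.
≡2[mod3]⇒2+3k : ∀ q → q ≡ 2 [mod 3 ] → ∃ λ k → q ≡ 2 ℕ.+ 3 ℕ.* k
≡2[mod3]⇒2+3k 0             3∣2 = contradiction 3∣2 (from-no (3 ℕ.∣? 2))
≡2[mod3]⇒2+3k 1             3∣1 = contradiction 3∣1 (from-no (3 ℕ.∣? 1))
≡2[mod3]⇒2+3k (suc (suc q)) (divides k q≡k*3) = k , ≡.cong (2 ℕ.+_) (≡.trans q≡k*3 (ℕ.*-comm k 3))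

-- Counting the points of the curve

NonZeroIn : ∀ {c ℓ q} → FiniteField q c ℓ → ℕ → Set ℓ
NonZeroIn F n = ¬ (n times 1# ≈ 0#)
  where open FiniteField F

module CurvePoints {c ℓ : Level} {q : ℕ} (F : FiniteField q c ℓ)
  (2≉0 : NonZeroIn F 2) (3≉0 : NonZeroIn F 3) where
  open FiniteField F hiding (zero)
  open FiniteFieldProperties F
  open FieldArithmetic F
  open Cubic 2≉0 3≉0
  open Characters F
  open CharacterProperties F
  open SemiringExp semiring using (^-congˡ)

  -- The affine substitution x = s v + t permutes the field. The monoid is arbitrary since the same
  -- step is needed for indicators in ℕ and for characters in ℂ.
  cubic-reindex : ∀ {m₁ m₂} (M : CommutativeMonoid m₁ m₂) → let open CommutativeMonoid M using () renaming (_≈_ to _≈ᴹ_) in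
    ∀ g → (∀ {x y} → x ≈ y → g x ≈ᴹ g y) →
    Sums.sumᶠ M (λ x → g (cubic x)) ≈ᴹ Sums.sumᶠ M (λ v → g (a * (v ^ 3 - 1#)))
  cubic-reindex M g g-cong = M.trans (M.sym (reindex-+ t (g ∘ cubic) (g-cong ∘ cubic-cong)))
    (M.trans (M.sym (reindex-* s≉0 (λ x → g (cubic (x + t))) (g-cong ∘ cubic-cong ∘ +-congʳ)))
      (sum-cong-≋ (λ i → g-cong (cubic-depressed (element i)))))
    where
    module M = CommutativeMonoid M
    open Sums M
    open CommutativeMonoidSum M using (sum-cong-≋)

  module _ (l : ℕ) where
    open Curve F l (+ 1 / 3)

    #affinePoints≡ : #affinePoints ≡ Σᴺ (λ i → count-powers l (cubic (element i)))
    #affinePoints≡ = ≡.trans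
      (≡.cong (λ xs → List.length (List.filter onCurve? (List.cartesianProduct xs xs))) (List.map-tabulate id element))
      (length-filter-product onCurve? element element)

    #affinePoints-cube-roots : ∀ k → q ≡ 2 ℕ.+ 3 ℕ.* k → #affinePoints ≡ q
    #affinePoints-cube-roots k q≡2+3k = ≡.trans #affinePoints≡
      (≡.trans (Σᴺ-comm {q} {q} (λ i j → 𝟙 (element j ^ l ≟ cubic (element i))))
        (≡.trans (Σᴺ-cong {q} (λ j → one (element j ^ l))) (Σᴺ-1 q)))
      where
      open CubeRoot k q≡2+3k
      one : ∀ z → Σᴺ (λ i → 𝟙 (z ≟ cubic (element i))) ≡ 1
      one z = begin
        Σᴺ (λ i → g (cubic (element i)))                ≡⟨ cubic-reindex ℕ.+-0-commutativeMonoid g g-cong ⟩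
        Σᴺ (λ i → g (a * (element i ^ 3 - 1#)))         ≡⟨ Σℕ.reindex (_^ 3) cube-root (^-congˡ 3) (^-congˡ (1 ℕ.+ 2 ℕ.* k))
                                                             cube-root-cube cube-cube-root (λ w → g (a * (w - 1#)))
                                                             (g-cong ∘ *-congˡ ∘ +-congʳ) ⟩
        Σᴺ (λ i → g (a * (element i - 1#)))             ≡⟨ Σℕ.reindex-+ (- 1#) (λ w → g (a * w)) (g-cong ∘ *-congˡ) ⟩
        Σᴺ (λ i → g (a * element i))                    ≡⟨ Σℕ.reindex-* a≉0 g g-cong ⟩
        Σᴺ (λ i → g (element i))                        ≡⟨ count-≈′ z ⟩
        1                                               ∎
        where
        open ≡.≡-Reasoning
        g : Carrier → ℕ
        g w = 𝟙 (z ≟ w)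
        g-cong : ∀ {x y} → x ≈ y → g x ≡ g y
        g-cong {x} {y} x≈y = 𝟙-cong (z ≟ x) (z ≟ y) (λ eq → trans eq x≈y) (λ eq → trans eq (sym x≈y))

  open SetoidReasoning ℂᵣ.setoid

  -- The squeeze gives the count at enumerated elements only; both sides respect the equality of the
  -- field, which extends it to every z.
  count-powers-value : ∀ {n χ} → CharacterOfOrder n χ → ∀ z → ι (count-powers n z) ≈ᶜ power-sum n χ z
  count-powers-value {n} {χ} χ-order z = begin
    ι (count-powers n z)                     ≡⟨ ≡.cong ι (Σᴺ-cong {q} (λ i → 𝟙-cong (element i ^ n ≟ z) (element i ^ n ≟ z′)
                                                  (λ eq → trans eq z≈z′) (λ eq → trans eq (sym z≈z′)))) ⟩
    ι (count-powers n z′)                    ≈⟨ CountPowers.count-powers≈ χ-order (index z) ⟩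
    power-sum n χ z′                         ≈⟨ ℂᵣ.+-congˡ (Σᶜ-cong {n ℕ.∸ 1} (λ k → Character.⟦⟧-cong (χ ^ᵡ suc (toℕ k)) (sym z≈z′))) ⟩
    power-sum n χ z                          ∎
    where
    z′ = element (index z)
    z≈z′ : z ≈ z′
    z≈z′ = sym (element-index z)

  #affinePoints-characters : ∀ {l S} → CharacterOfOrder l S →
    ι (Curve.#affinePoints F l (+ 1 / 3)) ≈ᶜ ι q +ᶜ Σ[1≤i< l ] (λ k → Σᶜ (λ i → ⟦ S ^ᵡ k ⟧ (cubic (element i))))
  #affinePoints-characters {l} {S} S-order = begin
    ι (Curve.#affinePoints F l (+ 1 / 3))
      ≡⟨ ≡.cong ι (#affinePoints≡ l) ⟩
    ι (Σᴺ (λ i → count-powers l (cubic (element i))))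
      ≈⟨ ι-sum {q} (λ i → count-powers l (cubic (element i))) ⟩
    Σᶜ (λ i → ι (count-powers l (cubic (element i))))
      ≈⟨ Σᶜ-cong {q} (λ i → count-powers-value S-order (cubic (element i))) ⟩
    Σᶜ (λ i → power-sum l S (cubic (element i)))
      ≈⟨ Σᶜ-+ {q} (λ _ → ℂᵣ.1#) (λ i → Σ[1≤i< l ] (λ k → ⟦ S ^ᵡ k ⟧ (cubic (element i)))) ⟩
    Σᶜ {q} (λ _ → ℂᵣ.1#) +ᶜ Σᶜ (λ i → Σ[1≤i< l ] (λ k → ⟦ S ^ᵡ k ⟧ (cubic (element i))))
      ≈⟨ ℂᵣ.+-cong (ℂᵣ.trans (Σᶜ-const q ℂᵣ.1#) (ℂᵣ.*-identityʳ (ι q)))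
           (Σᶜ-comm {q} {l ℕ.∸ 1} (λ i k → ⟦ S ^ᵡ suc (toℕ k) ⟧ (cubic (element i)))) ⟩
    ι q +ᶜ Σ[1≤i< l ] (λ k → Σᶜ (λ i → ⟦ S ^ᵡ k ⟧ (cubic (element i)))) ∎

  -- Jacobi sums and binomial coefficients

  Σ-cubes : ∀ (h : Carrier → ℂ) → (∀ {x y} → x ≈ y → h x ≈ᶜ h y) →
            Σᶜ {q} (λ i → h (element i ^ 3)) ≈ᶜ Σᶜ {q} (λ i → ι (count-powers 3 (element i)) *ᶜ h (element i))
  Σ-cubes h h-cong = begin
    -- Summation over the fibres of cubing: each value is first written as a sum against an
    -- indicator, and then the two sums are exchanged.
    Σᶜ {q} (λ j → h (element j ^ 3))                                                    ≈⟨ Σᶜ-cong {q} (λ j → pick (element j ^ 3)) ⟨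
    Σᶜ (λ j → Σᶜ (λ i → ι (δ j i) *ᶜ h (element i)))                                ≈⟨ Σᶜ-comm {q} {q} (λ j i → ι (δ j i) *ᶜ h (element i)) ⟩
    Σᶜ (λ i → Σᶜ (λ j → ι (δ j i) *ᶜ h (element i)))                                ≈⟨ Σᶜ-cong {q} (λ i → *-distribʳ-Σᶜ {q} (h (element i)) (λ j → ι (δ j i))) ⟨
    Σᶜ (λ i → Σᶜ (λ j → ι (δ j i)) *ᶜ h (element i))                                ≈⟨ Σᶜ-cong {q} (λ i → ℂᵣ.*-congʳ (ι-sum {q} (λ j → δ j i))) ⟨
    Σᶜ (λ i → ι (count-powers 3 (element i)) *ᶜ h (element i))                      ∎
    where
    δ : Fin q → Fin q → ℕ
    δ j i = 𝟙 (element j ^ 3 ≟ element i)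

    pick : ∀ z → Σᶜ (λ i → ι (𝟙 (z ≟ element i)) *ᶜ h (element i)) ≈ᶜ h z
    pick z = ℂᵣ.trans
      (Σℂ.sumᶠ-single (λ w → ι (𝟙 (z ≟ w)) *ᶜ h w) z
        (λ {x} {y} x≈y → ℂᵣ.*-cong (ℂᵣ.reflexive (≡.cong ι (𝟙-cong (z ≟ x) (z ≟ y)
          (λ eq → trans eq x≈y) (λ eq → trans eq (sym x≈y))))) (h-cong x≈y))
        (λ w w≉z → ℂᵣ.trans (ℂᵣ.*-congʳ (ℂᵣ.reflexive (≡.cong ι (𝟙-no (z ≟ w) (w≉z ∘ sym))))) (ℂᵣ.zeroˡ (h w))))
      (ℂᵣ.trans (ℂᵣ.*-congʳ (ℂᵣ.reflexive (≡.cong ι (𝟙-yes (z ≟ z) refl)))) (ℂᵣ.*-identityˡ (h z)))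

  -- The Jacobi sum with x - 1 in place of 1 - x; it differs from the usual one by B(-1), the very
  -- factor that the binomial coefficient carries.
  jacobi : Character → Character → ℂ
  jacobi A B = Σᶜ (λ i → ⟦ A ⟧ (element i) *ᶜ ⟦ B ⟧ (element i - 1#))

  Σ-cubic : ∀ {χ} → CharacterOfOrder 3 χ → ∀ B → Σᶜ (λ i → ⟦ B ⟧ (element i)) ≈ᶜ ℂᵣ.0# →
            Σᶜ (λ i → ⟦ B ⟧ (cubic (element i))) ≈ᶜ ⟦ B ⟧ a *ᶜ (jacobi χ B +ᶜ jacobi (χ ^ᵡ 2) B)
  Σ-cubic {χ} χ-order B ΣB≈0 = begin
    Σᶜ (λ i → ⟦ B ⟧ (cubic (element i)))
      ≈⟨ cubic-reindex ℂᵣ.+-commutativeMonoid ⟦ B ⟧ B-cong ⟩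
    Σᶜ (λ i → ⟦ B ⟧ (a * (element i ^ 3 - 1#)))
      ≈⟨ Σᶜ-cong {q} (λ i → Character.homo B a (element i ^ 3 - 1#)) ⟩
    Σᶜ (λ i → ⟦ B ⟧ a *ᶜ ⟦ B ⟧ (element i ^ 3 - 1#))
      ≈⟨ *-distribˡ-Σᶜ {q} (⟦ B ⟧ a) (λ i → ⟦ B ⟧ (element i ^ 3 - 1#)) ⟨
    ⟦ B ⟧ a *ᶜ Σᶜ (λ i → h (element i ^ 3))
      ≈⟨ ℂᵣ.*-congˡ (Σ-cubes h h-cong) ⟩
    ⟦ B ⟧ a *ᶜ Σᶜ (λ i → ι (count-powers 3 (element i)) *ᶜ h (element i))
      ≈⟨ ℂᵣ.*-congˡ (Σᶜ-cong {q} (λ i → expand (element i))) ⟩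
    ⟦ B ⟧ a *ᶜ Σᶜ (λ i → h (element i) +ᶜ (term χ (element i) +ᶜ term (χ ^ᵡ 2) (element i)))
      ≈⟨ ℂᵣ.*-congˡ (Σᶜ-+ {q} (λ i → h (element i)) (λ i → term χ (element i) +ᶜ term (χ ^ᵡ 2) (element i))) ⟩
    ⟦ B ⟧ a *ᶜ (Σᶜ (λ i → h (element i)) +ᶜ Σᶜ (λ i → term χ (element i) +ᶜ term (χ ^ᵡ 2) (element i)))
      ≈⟨ ℂᵣ.*-congˡ (ℂᵣ.+-cong (ℂᵣ.trans (Σℂ.reindex-+ (- 1#) ⟦ B ⟧ B-cong) ΣB≈0)
           (Σᶜ-+ {q} (λ i → term χ (element i)) (λ i → term (χ ^ᵡ 2) (element i)))) ⟩
    ⟦ B ⟧ a *ᶜ (ℂᵣ.0# +ᶜ (jacobi χ B +ᶜ jacobi (χ ^ᵡ 2) B))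
      ≈⟨ ℂᵣ.*-congˡ (ℂᵣ.+-identityˡ _) ⟩
    ⟦ B ⟧ a *ᶜ (jacobi χ B +ᶜ jacobi (χ ^ᵡ 2) B) ∎
    where
    B-cong : ∀ {x y} → x ≈ y → ⟦ B ⟧ x ≈ᶜ ⟦ B ⟧ y
    B-cong = Character.⟦⟧-cong B

    h : Carrier → ℂ
    h w = ⟦ B ⟧ (w - 1#)

    h-cong : ∀ {x y} → x ≈ y → h x ≈ᶜ h y
    h-cong = B-cong ∘ +-congʳ

    term : Character → Carrier → ℂ
    term A w = ⟦ A ⟧ w *ᶜ h w

    expand : ∀ w → ι (count-powers 3 w) *ᶜ h w ≈ᶜ h w +ᶜ (term χ w +ᶜ term (χ ^ᵡ 2) w)
    expand w = begin
      ι (count-powers 3 w) *ᶜ h w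
        ≈⟨ ℂᵣ.*-congʳ (count-powers-value χ-order w) ⟩
      (ℂᵣ.1# +ᶜ (⟦ χ ^ᵡ 1 ⟧ w +ᶜ (⟦ χ ^ᵡ 2 ⟧ w +ᶜ ℂᵣ.0#))) *ᶜ h w
        ≈⟨ ℂᵣ.*-congʳ (ℂᵣ.+-congˡ (ℂᵣ.+-cong (AbelianGroup.identityʳ characterGroup χ w) (ℂᵣ.+-identityʳ (⟦ χ ^ᵡ 2 ⟧ w)))) ⟩
      (ℂᵣ.1# +ᶜ (⟦ χ ⟧ w +ᶜ ⟦ χ ^ᵡ 2 ⟧ w)) *ᶜ h w
        ≈⟨ ℂᵣ.distribʳ (h w) ℂᵣ.1# _ ⟩
      ℂᵣ.1# *ᶜ h w +ᶜ (⟦ χ ⟧ w +ᶜ ⟦ χ ^ᵡ 2 ⟧ w) *ᶜ h w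
        ≈⟨ ℂᵣ.+-cong (ℂᵣ.*-identityˡ (h w)) (ℂᵣ.distribʳ (h w) (⟦ χ ⟧ w) (⟦ χ ^ᵡ 2 ⟧ w)) ⟩
      h w +ᶜ (term χ w +ᶜ term (χ ^ᵡ 2) w) ∎

  -- As -1 is its own inverse, C(-1) equals the inverse character at -1 and turns 1 - x into x - 1.
  -- `B` is related to `C` only pointwise because it will be a power of `S ‾`, while `C` is a power
  -- of `S`.
  q*binom : ∀ A C B → (∀ x → ⟦ B ⟧ x ≈ᶜ ⟦ C ⟧ (x ⁻¹)) → ι q *ᶜ binom A C ≈ᶜ jacobi A B
  q*binom A C B B≈C‾ = begin
    ι q *ᶜ ((C₋₁ *ᶜ 1/q) *ᶜ T)        ≈⟨ ℂᵣ.*-assoc (ι q) (C₋₁ *ᶜ 1/q) T ⟨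
    (ι q *ᶜ (C₋₁ *ᶜ 1/q)) *ᶜ T        ≈⟨ ℂᵣ.*-congʳ (ℂᵣ.*-congˡ (ℂᵣ.*-comm C₋₁ 1/q)) ⟩
    (ι q *ᶜ (1/q *ᶜ C₋₁)) *ᶜ T        ≈⟨ ℂᵣ.*-congʳ (ℂᵣ.*-assoc (ι q) 1/q C₋₁) ⟨
    ((ι q *ᶜ 1/q) *ᶜ C₋₁) *ᶜ T        ≈⟨ ℂᵣ.*-congʳ (ℂᵣ.*-congʳ (ι-inverse q {{order-nonZero}})) ⟩
    (ℂᵣ.1# *ᶜ C₋₁) *ᶜ T               ≈⟨ ℂᵣ.*-congʳ (ℂᵣ.*-identityˡ C₋₁) ⟩
    C₋₁ *ᶜ T                          ≈⟨ *-distribˡ-Σᶜ {q} C₋₁ (λ i → term (element i)) ⟩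
    Σᶜ (λ i → C₋₁ *ᶜ term (element i)) ≈⟨ Σᶜ-cong {q} (λ i → flip (element i)) ⟩
    jacobi A B                        ∎
    where
    C₋₁ = ⟦ C ⟧ (- 1#)

    term : Carrier → ℂ
    term x = ⟦ A ⟧ x *ᶜ ⟦ C ‾ ⟧ (1# - x)

    T = Σᶜ (λ i → term (element i))

    open import Algebra.Properties.Ring ring using (-1*x≈-x; -‿involutive; -‿anti-homo-+)

    -1*-1≈1 : - 1# * - 1# ≈ 1#
    -1*-1≈1 = trans (-1*x≈-x (- 1#)) (-‿involutive 1#)

    -1*[1-x]≈x-1 : ∀ x → - 1# * (1# - x) ≈ x - 1#
    -1*[1-x]≈x-1 x = trans (-1*x≈-x (1# - x)) (trans (-‿anti-homo-+ 1# (- x)) (+-congʳ (-‿involutive x)))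

    flip : ∀ x → C₋₁ *ᶜ term x ≈ᶜ ⟦ A ⟧ x *ᶜ ⟦ B ⟧ (x - 1#)
    flip x = begin
      C₋₁ *ᶜ (⟦ A ⟧ x *ᶜ ⟦ C ‾ ⟧ (1# - x))            ≈⟨ ℂᵣ.*-assoc C₋₁ (⟦ A ⟧ x) _ ⟨
      (C₋₁ *ᶜ ⟦ A ⟧ x) *ᶜ ⟦ C ‾ ⟧ (1# - x)            ≈⟨ ℂᵣ.*-congʳ (ℂᵣ.*-comm C₋₁ (⟦ A ⟧ x)) ⟩
      (⟦ A ⟧ x *ᶜ C₋₁) *ᶜ ⟦ C ‾ ⟧ (1# - x)            ≈⟨ ℂᵣ.*-assoc (⟦ A ⟧ x) C₋₁ _ ⟩
      ⟦ A ⟧ x *ᶜ (C₋₁ *ᶜ ⟦ C ‾ ⟧ (1# - x))            ≈⟨ ℂᵣ.*-congˡ (ℂᵣ.*-congʳ (Character.⟦⟧-cong C (⁻¹-unique -1*-1≈1))) ⟩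
      ⟦ A ⟧ x *ᶜ (⟦ C ‾ ⟧ (- 1#) *ᶜ ⟦ C ‾ ⟧ (1# - x)) ≈⟨ ℂᵣ.*-congˡ (Character.homo (C ‾) (- 1#) (1# - x)) ⟨
      ⟦ A ⟧ x *ᶜ ⟦ C ‾ ⟧ (- 1# * (1# - x))            ≈⟨ ℂᵣ.*-congˡ (Character.⟦⟧-cong (C ‾) (-1*[1-x]≈x-1 x)) ⟩
      ⟦ A ⟧ x *ᶜ ⟦ C ‾ ⟧ (x - 1#)                     ≈⟨ ℂᵣ.*-congˡ (B≈C‾ (x - 1#)) ⟨
      ⟦ A ⟧ x *ᶜ ⟦ B ⟧ (x - 1#)                       ∎

  ⁻¹-nonZero : ∀ {x} → ¬ (x ≈ 0#) → ¬ (x ⁻¹ ≈ 0#)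
  ⁻¹-nonZero {x} x≉0 x⁻¹≈0 = 0≉1 (trans (sym (zeroʳ x)) (trans (*-congˡ (sym x⁻¹≈0)) (⁻¹-inverseʳ x≉0)))

  trivialValue-⁻¹ : ∀ x → trivialValue (x ⁻¹) ≈ᶜ trivialValue x
  trivialValue-⁻¹ x = aux (x ≟ 0#)
    where
    aux : Dec (x ≈ 0#) → trivialValue (x ⁻¹) ≈ᶜ trivialValue x
    aux (yes x≈0) = ℂᵣ.trans (trivialValue-zero (⁻¹-zero x≈0)) (ℂᵣ.sym (trivialValue-zero x≈0))
    aux (no x≉0)  = ℂᵣ.trans (trivialValue-nonZero (⁻¹-nonZero x≉0)) (ℂᵣ.sym (trivialValue-nonZero x≉0))

  ⁻¹-involutive : ∀ x → (x ⁻¹) ⁻¹ ≈ x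
  ⁻¹-involutive x = aux (x ≟ 0#)
    where
    aux : Dec (x ≈ 0#) → (x ⁻¹) ⁻¹ ≈ x
    aux (yes x≈0) = trans (⁻¹-zero (⁻¹-zero x≈0)) (sym x≈0)
    aux (no x≉0)  = sym (⁻¹-unique (trans (*-comm (x ⁻¹) x) (⁻¹-inverseʳ x≉0)))

  ‾-^ᵡ : ∀ χ n x → ⟦ χ ‾ ^ᵡ n ⟧ x ≈ᶜ ⟦ χ ^ᵡ n ⟧ (x ⁻¹)
  ‾-^ᵡ χ zero    x = ℂᵣ.sym (trivialValue-⁻¹ x)
  ‾-^ᵡ χ (suc n) x = ℂᵣ.*-congˡ (‾-^ᵡ χ n x)

  -- Inversion on the field is an involution that preserves the trivial character, so triviality of
  -- a power passes in both directions.
  ‾-order : ∀ {n χ} → CharacterOfOrder n χ → CharacterOfOrder n (χ ‾)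
  ‾-order {n} {χ} (0<n , χⁿ≈1 , minimal) =
    0<n ,
    (λ x → ℂᵣ.trans (‾-^ᵡ χ n x) (ℂᵣ.trans (χⁿ≈1 (x ⁻¹)) (trivialValue-⁻¹ x))) ,
    λ m 0<m m<n χ‾ᵐ≈1 → minimal m 0<m m<n (λ x →
      ℂᵣ.trans (Character.⟦⟧-cong (χ ^ᵡ m) (sym (⁻¹-involutive x)))
        (ℂᵣ.trans (ℂᵣ.sym (‾-^ᵡ χ m (x ⁻¹))) (ℂᵣ.trans (χ‾ᵐ≈1 (x ⁻¹)) (trivialValue-⁻¹ x))))

  #affinePoints-binom : ∀ {l S χ} → CharacterOfOrder l S → CharacterOfOrder 3 χ →
    ι (Curve.#affinePoints F l (+ 1 / 3)) ≈ᶜ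
    ι q +ᶜ ι q *ᶜ Σ[1≤i< l ] (λ k → ⟦ S ‾ ^ᵡ k ⟧ a *ᶜ (binom χ (S ^ᵡ k) +ᶜ binom (χ ^ᵡ 2) (S ^ᵡ k)))
  #affinePoints-binom {l} {S} {χ} S-order χ-order = ℂᵣ.trans (#affinePoints-characters S‾-order) (ℂᵣ.+-congˡ (begin
    Σ[1≤i< l ] (λ k → Σᶜ (λ i → ⟦ S ‾ ^ᵡ k ⟧ (cubic (element i))))
      ≈⟨ Σ[1≤i<]-cong l {{ℕ.>-nonZero (proj₁ S-order)}} each ⟩
    Σ[1≤i< l ] (λ k → ι q *ᶜ summand k)
      ≈⟨ *-distribˡ-Σᶜ {l ℕ.∸ 1} (ι q) (λ k → summand (suc (toℕ k))) ⟨
    ι q *ᶜ Σ[1≤i< l ] summand ∎))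
    where
    S‾-order : CharacterOfOrder l (S ‾)
    S‾-order = ‾-order S-order

    summand : ℕ → ℂ
    summand k = ⟦ S ‾ ^ᵡ k ⟧ a *ᶜ (binom χ (S ^ᵡ k) +ᶜ binom (χ ^ᵡ 2) (S ^ᵡ k))

    each : ∀ k → 0 ℕ.< k → k ℕ.< l → Σᶜ (λ i → ⟦ S ‾ ^ᵡ k ⟧ (cubic (element i))) ≈ᶜ ι q *ᶜ summand k
    each k 0<k k<l = begin
      Σᶜ (λ i → ⟦ B ⟧ (cubic (element i)))
        ≈⟨ Σ-cubic χ-order B (power-sum≈0 S‾-order k 0<k k<l) ⟩
      ⟦ B ⟧ a *ᶜ (jacobi χ B +ᶜ jacobi (χ ^ᵡ 2) B)
        ≈⟨ ℂᵣ.*-congˡ (ℂᵣ.+-cong (q*binom χ (S ^ᵡ k) B (‾-^ᵡ S k)) (q*binom (χ ^ᵡ 2) (S ^ᵡ k) B (‾-^ᵡ S k))) ⟨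
      ⟦ B ⟧ a *ᶜ (ι q *ᶜ b₁ +ᶜ ι q *ᶜ b₂)
        ≈⟨ ℂᵣ.*-congˡ (ℂᵣ.distribˡ (ι q) b₁ b₂) ⟨
      ⟦ B ⟧ a *ᶜ (ι q *ᶜ (b₁ +ᶜ b₂))
        ≈⟨ ℂᵣ.*-assoc (⟦ B ⟧ a) (ι q) _ ⟨
      (⟦ B ⟧ a *ᶜ ι q) *ᶜ (b₁ +ᶜ b₂)
        ≈⟨ ℂᵣ.*-congʳ (ℂᵣ.*-comm (⟦ B ⟧ a) (ι q)) ⟩
      (ι q *ᶜ ⟦ B ⟧ a) *ᶜ (b₁ +ᶜ b₂)
        ≈⟨ ℂᵣ.*-assoc (ι q) (⟦ B ⟧ a) _ ⟩
      ι q *ᶜ summand k ∎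
      where
      B = S ‾ ^ᵡ k
      b₁ = binom χ (S ^ᵡ k)
      b₂ = binom (χ ^ᵡ 2) (S ^ᵡ k)

  -- One point at infinity cancels the 1 in 1 + q, and `d` counts the others: 0, or 2 for l = 3.
  -- Adding 1 + q to both sides avoids subtraction in ℂ.
  -a-q : ∀ l d {X} → Curve.#pointsAtInfinity F l (+ 1 / 3) ≡ suc d →
         ι (Curve.#affinePoints F l (+ 1 / 3)) ≈ᶜ ι q +ᶜ X →
         fromℤ (ℤ.- Curve.a-q F l (+ 1 / 3)) ≈ᶜ ι d +ᶜ X
  -a-q l d {X} ∞≡1+d N≈q+X = +-cancelˡ (ι (1 ℕ.+ q)) (fromℤ (ℤ.- a-q)) (ι d +ᶜ X) (begin
    ι (1 ℕ.+ q) +ᶜ fromℤ (ℤ.- a-q)              ≈⟨ fromℤ-+ (+ (1 ℕ.+ q)) (ℤ.- a-q) ⟨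
    fromℤ (+ (1 ℕ.+ q) ℤ.+ ℤ.- a-q)             ≡⟨ ≡.cong fromℤ (restore (+ (1 ℕ.+ q)) (+ #points)) ⟩
    ι #points                                   ≡⟨ ≡.cong (λ m → ι (m ℕ.+ #affinePoints)) ∞≡1+d ⟩
    ι (suc d ℕ.+ #affinePoints)                 ≈⟨ ι-+ (suc d) #affinePoints ⟩
    ι (suc d) +ᶜ ι #affinePoints                ≈⟨ ℂᵣ.+-cong (ι-suc d) N≈q+X ⟩
    (ℂᵣ.1# +ᶜ ι d) +ᶜ (ι q +ᶜ X)                ≈⟨ interchange ℂᵣ.1# (ι d) (ι q) X ⟩
    (ℂᵣ.1# +ᶜ ι q) +ᶜ (ι d +ᶜ X)                ≈⟨ ℂᵣ.+-congʳ (ι-suc q) ⟨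
    ι (1 ℕ.+ q) +ᶜ (ι d +ᶜ X)                   ∎)
    where
    open Curve F l (+ 1 / 3)
    open import Algebra.Properties.Ring ℂᵣ.ring using (+-cancelˡ)
    open import Algebra.Properties.CommutativeSemigroup ℂᵣ.+-commutativeSemigroup using (interchange)
    restore : ∀ u v → u ℤ.+ ℤ.- (u ℤ.- v) ≡ v
    restore u v = ≡.trans (≡.cong (λ w → u ℤ.+ w) (≡.trans (ℤ.neg-distrib-+ u (ℤ.- v)) (≡.cong (λ w → ℤ.- u ℤ.+ w) (ℤ.neg-involutive v))))
      (≡.trans (≡.sym (ℤ.+-assoc u (ℤ.- u) v)) (≡.trans (≡.cong (λ w → w ℤ.+ v) (ℤ.+-inverseʳ u)) (ℤ.+-identityˡ v)))

  one-at-infinity : ∀ {l} → l ≢ 3 → Curve.#pointsAtInfinity F l (+ 1 / 3) ≡ 1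
  one-at-infinity {l} l≢3 = ≡.cong (λ b → if b then 3 else 1) (dec-false (l ℕ.≟ 3) l≢3)

  twist : ∀ S k → ⟦ S ‾ ^ᵡ k ⟧ a ≈ᶜ ⟦ S ^ᵡ k ⟧ (reduce (+ 27 / 8))
  twist S k = ℂᵣ.trans (‾-^ᵡ S k a) (Character.⟦⟧-cong (S ^ᵡ k) a⁻¹≈27/8)

  -- The factor a = s³ is a cube, which is why no value at 27/8 appears in the formula for l = 3.
  twist-cubic : ∀ {χ} → CharacterOfOrder 3 χ → ∀ k → ⟦ χ ‾ ^ᵡ k ⟧ a ≈ᶜ ℂᵣ.1#
  twist-cubic {χ} χ-order k = ℂᵣ.trans (^ᵡ-value (χ ‾) k a≉0)
    (^ᶜ-1 k (ℂᵣ.trans (χ-^ (χ ‾) 3 s) (order-value (‾-order χ-order) s≉0)))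

-- The three cases of the formula

open import Data.Integer.Base using (-_)
open import Data.Nat.Base using (_≤_; _^_)

theorem1p5 : {c ℓ : Level} (l p e q : ℕ) → 2 ≤ l →
    Prime p → p ≢ 2 → p ≢ 3 → 1 ≤ e → q ≡ p ^ e → q ≡ 1 [mod l ] →
    (F : FiniteField q c ℓ) →
    let open FiniteField F using (reduce)
        open Characters F
        open Curve F l (+ 1 / 3)
    in
    (S : Character) → CharacterOfOrder l S →
      (l ≢ 3 → q ≡ 2 [mod 3 ] → fromℤ (- a-q) ≈ᶜ fromℤ (+ 0))
    × (l ≢ 3 → q ≡ 1 [mod 3 ] → (χ₃ : Character) → CharacterOfOrder 3 χ₃ →
        fromℤ (- a-q) ≈ᶜ
          fromℤ (+ q) *ᶜ Σ[1≤i< l ] (λ i →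
            ⟦ S ^ᵡ i ⟧ (reduce (+ 27 / 8)) *ᶜ
              (binom χ₃ (S ^ᵡ i) +ᶜ binom (χ₃ ^ᵡ 2) (S ^ᵡ i))))
    × (l ≡ 3 → (χ₃ : Character) → CharacterOfOrder 3 χ₃ →
        fromℤ (- a-q) ≈ᶜ
          fromℤ (+ 2) +ᶜ fromℤ (+ q) *ᶜ Σ[1≤i< 3 ] (λ i →
            binom χ₃ (χ₃ ^ᵡ i) +ᶜ binom (χ₃ ^ᵡ 2) (χ₃ ^ᵡ i)))
theorem1p5 l p e q _ p-prime p≢2 p≢3 _ q≡pᵉ _ F S S-order = inert , split , trigonal
  where
  open FiniteField F using (reduce)
  open Characters F
  open Curve F l (+ 1 / 3) using (a-q)

  -- Once p > 3, both 2 and 3 are coprime to p and hence non-zero in the field.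
  2<p : 2 ℕ.< p
  2<p = ℕ.≤∧≢⇒< (ℕ.nonTrivial⇒n>1 p {{prime⇒nonTrivial p-prime}}) (p≢2 ∘ ≡.sym)

  3<p : 3 ℕ.< p
  3<p = ℕ.≤∧≢⇒< 2<p (p≢3 ∘ ≡.sym)

  open CurvePoints F (FieldArithmetic.coprime⇒nonZero F e q≡pᵉ (Coprime.prime⇒coprime p-prime 2<p))
                     (FieldArithmetic.coprime⇒nonZero F e q≡pᵉ (Coprime.prime⇒coprime p-prime 3<p))

  inert : l ≢ 3 → q ≡ 2 [mod 3 ] → fromℤ (- a-q) ≈ᶜ fromℤ (+ 0)
  inert l≢3 q≡2 = let k , q≡2+3k = ≡2[mod3]⇒2+3k q q≡2 in
    ℂᵣ.trans (-a-q l 0 (one-at-infinity l≢3)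
      (ℂᵣ.trans (ℂᵣ.reflexive (≡.cong ι (#affinePoints-cube-roots l k q≡2+3k))) (ℂᵣ.sym (ℂᵣ.+-identityʳ (ι q)))))
    (ℂᵣ.+-identityʳ (ι 0))

  split : l ≢ 3 → q ≡ 1 [mod 3 ] → (χ₃ : Character) → CharacterOfOrder 3 χ₃ →
    fromℤ (- a-q) ≈ᶜ
      fromℤ (+ q) *ᶜ Σ[1≤i< l ] (λ i →
        ⟦ S ^ᵡ i ⟧ (reduce (+ 27 / 8)) *ᶜ
          (binom χ₃ (S ^ᵡ i) +ᶜ binom (χ₃ ^ᵡ 2) (S ^ᵡ i)))
  split l≢3 _ χ₃ χ₃-order = ℂᵣ.trans
    (-a-q l 0 (one-at-infinity l≢3) (#affinePoints-binom S-order χ₃-order))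
    (ℂᵣ.trans (ℂᵣ.+-identityˡ _) (ℂᵣ.*-congˡ {ι q}
      (Σᶜ-cong {l ℕ.∸ 1} (λ k → ℂᵣ.*-congʳ (twist S (suc (toℕ k)))))))

  trigonal : l ≡ 3 → (χ₃ : Character) → CharacterOfOrder 3 χ₃ →
    fromℤ (- a-q) ≈ᶜ
      fromℤ (+ 2) +ᶜ fromℤ (+ q) *ᶜ Σ[1≤i< 3 ] (λ i →
        binom χ₃ (χ₃ ^ᵡ i) +ᶜ binom (χ₃ ^ᵡ 2) (χ₃ ^ᵡ i))
  -- Here `χ₃` has order l, so it serves to count both the y with a given cube and the v with a
  -- given cube.
  trigonal ≡.refl χ₃ χ₃-order = ℂᵣ.trans
    (-a-q 3 2 ≡.refl (#affinePoints-binom χ₃-order χ₃-order))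
    (ℂᵣ.+-congˡ {ι 2} (ℂᵣ.*-congˡ {ι q}
      (Σᶜ-cong {2} (λ k → ℂᵣ.trans (ℂᵣ.*-congʳ (twist-cubic χ₃-order (suc (toℕ k))))
        (ℂᵣ.*-identityˡ (binom χ₃ (χ₃ ^ᵡ suc (toℕ k)) +ᶜ binom (χ₃ ^ᵡ 2) (χ₃ ^ᵡ suc (toℕ k))))))))
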